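{- Let $t > 2$ and $1 \leq k_1 \leq \cdots \leq k_t$ be integers with $n = k_1 + \cdots + k_t \geq 4$, and let $X$ be a graph on $n$ vertices. If $X$ is a tree and does not contain an $(n-k_t)$-bridge, then $\mathsf{FS}(X, K_{k_1,\ldots,k_t})$ is connected.
   Context: All graphs are simple. For graphs $X, Y$ on $n$ vertices, the friends-and-strangers graph $\mathsf{FS}(X,Y)$ has as vertices all bijections $\sigma: V(X) \to V(Y)$; two bijections $\sigma, \sigma'$ are adjacent iff there is an edge $\{a,b\} \in E(X)$ with $\{\sigma(a),\sigma(b)\} \in E(Y)$, $\sigma'(a) = \sigma(b)$, $\sigma'(b) = \sigma(a)$, and $\sigma'(c) = \sigma(c)$ for all other $c$. $K_{k_1,\ldots,k_t}$ denotes the complete $t$-partite graph with partition classes of sizes $k_1,\ldots,k_t$. A path $v_1, \ldots, v_k$ in a graph is a $k$-bridge if each edge of the path is a cut-edge, $v_2,\ldots,v_{k-1}$ have degree $2$, and $v_1, v_k$ do not have degree $1$; a single cut-vertex is a $1$-bridge. -}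

module Defs where

open import Data.Nat using (ℕ; zero; suc)
open import Data.Fin using (Fin; zero; suc; inject₁; fromℕ)
open import Data.Product using (Σ; ∃; _×_; _,_; proj₁)
open import Data.Sum using (_⊎_)
open import Data.Empty using (⊥)
open import Relation.Nullary using (¬_)
open import Relation.Binary.PropositionalEquality using (_≡_; _≢_)
open import Relation.Binary.Construct.Closure.ReflexiveTransitive using (Star)
open import Function.Bundles using (_↔_; Inverse)
open import Function.Definitions using (Injective)

record Graph (V : Set) : Set₁ where
  field
    Adj   : V → V → Set
    sym   : ∀ {u v} → Adj u v → Adj v u
    irrefl : ∀ {v} → ¬ Adj v v
open Graph public

Reach : {V : Set} → (V → V → Set) → V → V → Set
Reach R = Star R

Connected : {V : Set} → Graph V → Set
Connected {V} G = ∀ (u v : V) → Reach (Adj G) u v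

HasCycle : {V : Set} → Graph V → Set
HasCycle {V} G =
  Σ ℕ λ m → Σ (Fin (suc (suc (suc m))) → V) λ c →
    Injective _≡_ _≡_ c
    × (∀ (i : Fin (suc (suc m))) → Adj G (c (inject₁ i)) (c (suc i)))
    × Adj G (c (fromℕ (suc (suc m)))) (c zero)

IsTree : {V : Set} → Graph V → Set
IsTree G = Connected G × ¬ HasCycle G

Degree1 : {V : Set} → Graph V → V → Set
Degree1 {V} G v = Σ V λ u → Adj G v u × (∀ x → Adj G v x → x ≡ u)

Degree2 : {V : Set} → Graph V → V → Set
Degree2 {V} G v = Σ V λ u → Σ V λ w → u ≢ w × Adj G v u × Adj G v w
                    × (∀ x → Adj G v x → x ≡ u ⊎ x ≡ w)

AdjMinusEdge : {V : Set} → Graph V → V → V → V → V → Set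
AdjMinusEdge G a b x y = Adj G x y × ¬ ((x ≡ a × y ≡ b) ⊎ (x ≡ b × y ≡ a))

CutEdge : {V : Set} → Graph V → V → V → Set
CutEdge G a b = Adj G a b × ¬ Reach (AdjMinusEdge G a b) a b

AdjMinusVertex : {V : Set} → Graph V → V → V → V → Set
AdjMinusVertex G v x y = Adj G x y × x ≢ v × y ≢ v

CutVertex : {V : Set} → Graph V → V → Set
CutVertex {V} G v = Σ V λ x → Σ V λ y → x ≢ v × y ≢ v
  × Reach (Adj G) x y × ¬ Reach (AdjMinusVertex G v) x y

-- G contains a k-bridge.  (k = 0 is meaningless: no 0-bridge.)
HasBridge : {V : Set} → Graph V → ℕ → Set
HasBridge G zero = ⊥
HasBridge {V} G (suc zero) = Σ V λ v → CutVertex G v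
HasBridge {V} G (suc (suc m)) = Σ (Fin (suc (suc m)) → V) λ p →
    Injective _≡_ _≡_ p
    × (∀ (i : Fin (suc m)) → CutEdge G (p (inject₁ i)) (p (suc i)))
    × (∀ (i : Fin m) → Degree2 G (p (suc (inject₁ i))))
    × ¬ Degree1 G (p zero)
    × ¬ Degree1 G (p (fromℕ (suc m)))

CompleteMultipartite : (t : ℕ) (k : Fin t → ℕ) → Graph (Σ (Fin t) λ i → Fin (k i))
CompleteMultipartite t k = record
  { Adj = λ x y → proj₁ x ≢ proj₁ y
  ; sym = λ p q → p (Relation.Binary.PropositionalEquality.sym q)
  ; irrefl = λ p → p Relation.Binary.PropositionalEquality.refl
  }

FSAdj : {A B : Set} → Graph A → Graph B → (A ↔ B) → (A ↔ B) → Set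
FSAdj {A} X Y σ σ' = Σ A λ a → Σ A λ b →
    Adj X a b × Adj Y (f a) (f b)
    × g a ≡ f b × g b ≡ f a
    × (∀ c → c ≢ a → c ≢ b → g c ≡ f c)
  where
    f = Inverse.to σ
    g = Inverse.to σ'

FSConnected : {A B : Set} → Graph A → Graph B → Set
FSConnected {A} {B} X Y = ∀ (σ τ : A ↔ B) → Σ (A ↔ B) λ ρ →
  Star (FSAdj X Y) σ ρ × (∀ a → Inverse.to ρ a ≡ Inverse.to τ a)

sumFin : (t : ℕ) → (Fin t → ℕ) → ℕ
sumFin zero k = 0
sumFin (suc t) k = k zero Data.Nat.+ sumFin t (λ i → k (suc i))

-- Transpositions along the edges of X generate all bijections, so it suffices to exchange two
-- labels p, q of one colour c on an edge ab of X. Exchangeability of p and q is invariant along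
-- walks in FS. Treat the labels of other colours as holes; there are at least m = n - k_t of them,
-- and a hole can be moved along any path of X.
--
-- If p and q sit on two leaves of a star K_{1,3} whose centre and third leaf are holes of different
-- colours, they can be exchanged inside the star, since FS(K_{1,3}, K_{1,1,2}) is connected; if
-- the two holes have equal colours, a label of a third colour is fetched first (t > 2). Hence it
-- is enough to lead p and q to a vertex of degree at least 3 with enough holes around it. The
-- degree-2 path through ab, extended until it meets leaves or vertices of degree at least 3, has
-- fewer than m non-leaf vertices, for otherwise it contains an m-bridge. By counting, on one side
-- of ab it ends in a vertex of degree at least 3 and there are enough holes on that side to vacate
-- the way to it and two of its further neighbours.
module Submission where

open import Defs hiding (sym)
open import Data.Nat using (ℕ; zero; suc; _≤_; _<_; _∸_; _+_; z≤n; s≤s; s≤s⁻¹)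
import Data.Nat.Properties as ℕₚ
open import Data.Fin using (Fin; zero; suc; inject₁; fromℕ; fromℕ<; inject≤) renaming (_≤_ to _≤ᶠ_)
import Data.Fin.Properties as Finₚ
open import Data.Product using (Σ; _×_; _,_; proj₁; proj₂)
open import Data.Sum using (_⊎_; inj₁; inj₂)
open import Data.Empty using (⊥; ⊥-elim)
open import Data.Unit using (⊤; tt)
open import Data.List using (List; []; _∷_; length; lookup; filter; allFin)
open import Data.List.Properties using (length-tabulate; filter-all; filter-notAll)
open import Data.List.Membership.Propositional using (_∈_; _∉_)
open import Data.List.Membership.Propositional.Properties
  using (∈-lookup; ∈-allFin; ∈-filter⁺; ∈-filter⁻)
open import Data.List.Relation.Unary.Any as Any using (here; there)
open import Data.List.Relation.Unary.All as All using (All; []; _∷_)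
open import Data.List.Relation.Unary.All.Properties using (¬Any⇒All¬)
open import Data.List.Relation.Unary.AllPairs using ([]; _∷_)
open import Data.List.Relation.Unary.Unique.Propositional using (Unique)
open import Data.List.Relation.Unary.Unique.Propositional.Properties using (allFin⁺; filter⁺)
open import Data.Fin.Permutation using (transpose)
import Data.Fin.Permutation.Components as PC
open import Function using (_∘_)
open import Function.Bundles using (_↔_; Inverse; Injection)
open import Function.Construct.Composition using (_↔-∘_)
open import Function.Construct.Symmetry using (↔-sym)
open import Function.Properties.Inverse using (↔⇒↣)
open import Function.Definitions using (Injective)
open import Relation.Nullary using (¬_; Dec; yes; no)
open import Relation.Nullary.Decidable using (_×-dec_; ¬?; dec-true; dec-false)
open import Relation.Binary.PropositionalEquality
  using (_≡_; _≢_; refl; sym; trans; cong; subst; ≢-sym)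
open import Relation.Binary.Construct.Closure.ReflexiveTransitive
  using (Star; ε; _◅_; _◅◅_; reverse)

-- Duplicate-free lists

lookup-injective : {A : Set} (l : List A) → Unique l → Injective _≡_ _≡_ (lookup l)
lookup-injective (x ∷ l) (x∉ ∷ u) {zero}  {zero}  e = refl
lookup-injective (x ∷ l) (x∉ ∷ u) {zero}  {suc j} e = ⊥-elim (All.lookup x∉ (∈-lookup j) e)
lookup-injective (x ∷ l) (x∉ ∷ u) {suc i} {zero}  e = ⊥-elim (All.lookup x∉ (∈-lookup i) (sym e))
lookup-injective (x ∷ l) (x∉ ∷ u) {suc i} {suc j} e = cong suc (lookup-injective l u e)

-- Each element goes to one list only, even where `P` and `Q` overlap, so the lengths add up
-- exactly. This serves to count holes by side of an edge and vertices by colour.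
separate : {A : Set} {P Q : A → Set} → (∀ x → P x ⊎ Q x) → ∀ {U} → Unique U
  → Σ (List A) λ Uᵖ → Σ (List A) λ Uᑫ → length Uᵖ + length Uᑫ ≡ length U
    × (Unique Uᵖ × All (λ u → u ∈ U × P u) Uᵖ) × (Unique Uᑫ × All (λ u → u ∈ U × Q u) Uᑫ)
separate cover [] = [] , [] , refl , ([] , []) , ([] , [])
separate cover {x ∷ U} (x∉ ∷ u) with separate cover u | cover x
... | Uᵖ , Uᑫ , eq , (uᵖ , sᵖ) , (uᑫ , sᑫ) | inj₁ s =
  x ∷ Uᵖ , Uᑫ , cong suc eq
  , (All.map (λ (∈U , _) → All.lookup x∉ ∈U) sᵖ ∷ uᵖ , (here refl , s) ∷ All.map (λ (∈U , s) → there ∈U , s) sᵖ)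
  , (uᑫ , All.map (λ (∈U , s) → there ∈U , s) sᑫ)
... | Uᵖ , Uᑫ , eq , (uᵖ , sᵖ) , (uᑫ , sᑫ) | inj₂ s =
  Uᵖ , x ∷ Uᑫ , trans (ℕₚ.+-suc (length Uᵖ) (length Uᑫ)) (cong suc eq)
  , (uᵖ , All.map (λ (∈U , s) → there ∈U , s) sᵖ)
  , (All.map (λ (∈U , _) → All.lookup x∉ ∈U) sᑫ ∷ uᑫ , (here refl , s) ∷ All.map (λ (∈U , s) → there ∈U , s) sᑫ)

module Delete {n : ℕ} (d : Fin n) where

  delete : List (Fin n) → List (Fin n)
  delete = filter (λ x → ¬? (x Finₚ.≟ d))

  delete-unique : ∀ {l} → Unique l → Unique (delete l)
  delete-unique = filter⁺ (λ x → ¬? (x Finₚ.≟ d))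

  delete-⊆ : ∀ {l x} → x ∈ delete l → x ∈ l × x ≢ d
  delete-⊆ = ∈-filter⁻ (λ x → ¬? (x Finₚ.≟ d))

  ∈-delete : ∀ {l x} → x ∈ l → x ≢ d → x ∈ delete l
  ∈-delete = ∈-filter⁺ (λ x → ¬? (x Finₚ.≟ d))

  length-delete : ∀ {l} → Unique l → length l ≤ suc (length (delete l))
  length-delete {[]} _ = z≤n
  length-delete {x ∷ l} (x∉ ∷ u) with x Finₚ.≟ d
  ... | yes refl = s≤s (ℕₚ.≤-reflexive (cong length (sym (filter-all _ (All.map ≢-sym x∉)))))
  ... | no _     = s≤s (length-delete u)

  length-delete-< : ∀ {l} → d ∈ l → length (delete l) < length l
  length-delete-< {l} d∈ = filter-notAll _ l (Any.map (λ e ≢d → ≢d (sym e)) d∈)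

open Delete using (delete; delete-unique; delete-⊆; ∈-delete; length-delete; length-delete-<)

-- Sides of an edge and branches at a vertex of a tree

module Tree {n : ℕ} (X : Graph (Fin n)) (conn : Connected X) (acyclic : ¬ HasCycle X) where

  open import Data.List.Membership.DecPropositional (Finₚ._≟_ {n}) using (_∈?_)

  V : Set
  V = Fin n

  _≟_ : (x y : V) → Dec (x ≡ y)
  _≟_ = Finₚ._≟_

  infix 4 _~_
  _~_ : V → V → Set
  _~_ = Adj X

  ~-sym : ∀ {a b} → a ~ b → b ~ a
  ~-sym = Graph.sym X

  ~⇒≢ : ∀ {a b} → a ~ b → a ≢ b
  ~⇒≢ e refl = irrefl X e

  Avoid : V → V → V → Set
  Avoid = AdjMinusVertex X

  Avoid-sym : ∀ {a x y} → Avoid a x y → Avoid a y x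
  Avoid-sym (e , p , q) = ~-sym e , q , p

  -- For an edge ab: the vertices on the a-side of it.
  Side : V → V → V → Set
  Side a b u = Star (Avoid b) u a

  Path : V → List V → V → Set
  Path x []      y = x ≡ y
  Path x (z ∷ l) y = x ~ z × Path z l y

  cut : ∀ {a x y z l} → x ∈ z ∷ l → Path z l y → Unique (z ∷ l) → All (_≢ a) (z ∷ l)
    → Σ (List V) λ l′ → Path x l′ y × Unique (x ∷ l′) × All (_≢ a) (x ∷ l′)
  cut (here refl) p u av = _ , p , u , av
  cut {l = _ ∷ _} (there m) (_ , p) (_ ∷ u) (_ ∷ av) = cut m p u av

  -- Loop erasure: if `x` already lies on the path found for the rest of the walk, `cut` keeps only
  -- the part from `x` on.
  simple-path : ∀ {a x y} → Star (Avoid a) x y → x ≢ a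
    → Σ (List V) λ l → Path x l y × Unique (x ∷ l) × All (_≢ a) (x ∷ l)
  simple-path ε x≢a = [] , refl , [] ∷ [] , x≢a ∷ []
  simple-path {x = x} (_◅_ {j = z} (e , _ , z≢a) w) x≢a with simple-path w z≢a
  ... | l , p , u , av with x ∈? (z ∷ l)
  ... | yes x∈ = cut x∈ p u av
  ... | no  x∉ = z ∷ l , (e , p) , ¬Any⇒All¬ _ x∉ ∷ u , x≢a ∷ av

  path-adj : ∀ {x y} l → Path x l y → ∀ (i : Fin (length l))
    → lookup (x ∷ l) (inject₁ i) ~ lookup (x ∷ l) (suc i)
  path-adj (z ∷ l) (e , p) zero    = e
  path-adj (z ∷ l) (e , p) (suc i) = path-adj l p i

  path-last : ∀ {x y} l → Path x l y → lookup (x ∷ l) (fromℕ (length l)) ≡ y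
  path-last []      p       = p
  path-last (z ∷ l) (_ , p) = path-last l p

  -- The only consequence of acyclicity that is used.
  branches-disjoint : ∀ {a x y} → a ~ x → a ~ y → x ≢ y → ¬ Side y a x
  branches-disjoint {a} {x} {y} ax ay x≢y w with simple-path w (~⇒≢ (~-sym ax))
  ... | [] , p , _ = x≢y p
  -- The path avoids `a`, so it closes through `a` to a cycle; since `x ≢ y`, that cycle has at
  -- least three vertices.
  ... | z ∷ l , p , u , av = acyclic
    ( length l , lookup L
    , lookup-injective L (All.map ≢-sym av ∷ u)
    , path-adj (x ∷ z ∷ l) (ax , p)
    , subst (_~ a) (sym (path-last (x ∷ z ∷ l) (ax , p))) (~-sym ay) )
    where
    L : List V
    L = a ∷ x ∷ z ∷ l

  side-≢ : ∀ {a b u} → a ≢ b → Side a b u → u ≢ b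
  side-≢ a≢b ε                   = a≢b
  side-≢ a≢b ((_ , u≢b , _) ◅ _) = u≢b

  side-cover : ∀ {a b} → a ~ b → ∀ u → Side a b u ⊎ Side b a u
  side-cover {a} {b} ab u = go (conn u a)
    where
    go : ∀ {u} → Star _~_ u a → Side a b u ⊎ Side b a u
    go ε = inj₁ ε
    go {u} (e ◅ w) with go w
    ... | inj₁ s with u ≟ b
    ...   | yes refl = inj₂ ε
    ...   | no  u≢b  = inj₁ ((e , u≢b , side-≢ (~⇒≢ ab) s) ◅ s)
    go {u} (e ◅ w) | inj₂ s with u ≟ a
    ...   | yes refl = inj₁ ε
    ...   | no  u≢a  = inj₂ ((e , u≢a , side-≢ (~⇒≢ (~-sym ab)) s) ◅ s)

  -- The walk is cut at its first arrival at `a`; the vertex before that is `a′`, and it differs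
  -- from `b` because the walk avoids `b`.
  descend : ∀ {a b u} → Side a b u
    → u ≡ a ⊎ Σ V λ a′ → a ~ a′ × a′ ≢ b × Side a′ a u
  descend ε = inj₁ refl
  descend {a} {u = u} ((e , u≢b , _) ◅ w) with descend w
  ... | inj₁ refl = inj₂ (u , ~-sym e , u≢b , ε)
  ... | inj₂ (a′ , aa′ , a′≢b , s) with u ≟ a
  ...   | yes u≡a = inj₁ u≡a
  ...   | no  u≢a = inj₂ (a′ , aa′ , a′≢b , (e , u≢a , side-≢ (~⇒≢ (~-sym aa′)) s) ◅ s)

  -- Branches at `a` are disjoint, so a walk inside the branch of `a′` cannot meet `b`; the edge
  -- from `a′` to `a` completes it.
  lift-side : ∀ {a a′ b u} → a ~ b → a ~ a′ → a′ ≢ b → Side a′ a u → Side a b u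
  lift-side ab aa′ a′≢b ε = (~-sym aa′ , a′≢b , ~⇒≢ ab) ◅ ε
  lift-side {b = b} {u} ab aa′ a′≢b w@((e , _) ◅ s) =
    (e , (λ { refl → branches-disjoint ab aa′ (≢-sym a′≢b) w }) , side-≢ (~⇒≢ ab) s′) ◅ s′
    where s′ = lift-side ab aa′ a′≢b s

  branch : ∀ a u → u ≡ a ⊎ Σ V λ x → a ~ x × Side x a u
  branch a u = go (conn u a)
    where
    go : ∀ {u} → Star _~_ u a → u ≡ a ⊎ Σ V λ x → a ~ x × Side x a u
    go ε = inj₁ refl
    go {u} (e ◅ w) with u ≟ a
    ... | yes p = inj₁ p
    ... | no  u≢a with go w
    ...   | inj₁ refl = inj₂ (u , ~-sym e , ε)
    ...   | inj₂ (x , ax , s) = inj₂ (x , ax , (e , u≢a , side-≢ (~⇒≢ (~-sym ax)) s) ◅ s)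

  -- Adjacency is an arbitrary type, but in a tree it can be decided: the branch at `a` that
  -- contains `b` has a unique root, and `b` is adjacent to `a` exactly if it is that root.
  adj? : ∀ a b → Dec (a ~ b)
  adj? a b with branch a b
  ... | inj₁ refl = no (irrefl X)
  ... | inj₂ (x , ax , s) with x ≟ b
  ...   | yes refl = yes ax
  ...   | no  x≢b  = no λ ab → branches-disjoint ab ax (≢-sym x≢b) s

  -- A walk from `a` that avoids the edge first enters `b` from another neighbour `x`, which would
  -- put `a` into the branch of `x` at `b`.
  tree-edge-cut : ∀ {a b} → a ~ b → CutEdge X a b
  tree-edge-cut {a} {b} ab = ab , λ w → arrive w (~⇒≢ ab)
    where
    go : ∀ {u} → Star (AdjMinusEdge X a b) u b → u ≢ b
      → Σ V λ x → b ~ x × x ≢ a × Side x b u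
    go ε u≢b = ⊥-elim (u≢b refl)
    go {u} (_◅_ {j = z} (e , ne) w) u≢b with z ≟ b
    ... | yes refl = u , ~-sym e , (λ u≡a → ne (inj₁ (u≡a , refl))) , ε
    ... | no  z≢b with go w z≢b
    ...   | x , bx , x≢a , s = x , bx , x≢a , (e , u≢b , z≢b) ◅ s
    arrive : Star (AdjMinusEdge X a b) a b → a ≢ b → ⊥
    arrive w a≢b with go w a≢b
    ... | x , bx , x≢a , s = branches-disjoint (~-sym ab) bx (≢-sym x≢a) s

  -- Arms, trails and bridges

  two-neighbours : ∀ {a x y} → a ~ x → a ~ y → x ≢ y → ¬ Degree1 X a
  two-neighbours ax ay x≢y (u , _ , only) = x≢y (trans (only _ ax) (sym (only _ ay)))

  -- The maximal path of degree-2 vertices that starts with the edge from b to a.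
  data Arm (b a : V) : Set where
    leaf : (∀ x → a ~ x → x ≡ b) → Arm b a
    fork : ∀ {x y} → a ~ x → a ~ y → x ≢ b → y ≢ b → x ≢ y → Arm b a
    pass : ∀ {a′} → a ~ a′ → a′ ≢ b → (∀ x → a ~ x → x ≡ b ⊎ x ≡ a′) → Arm a a′ → Arm b a

  -- For termination, `l` covers the `a`-side and `f` bounds its length. The side of the next edge
  -- is contained in this one and misses `a`, so `a` can be deleted from `l`.
  arm-within : ∀ {a b} (f : ℕ) (l : List V) → length l ≤ f → a ~ b
    → (∀ {u} → Side a b u → u ∈ l) → Arm b a
  arm-within {a} {b} f l l≤f ab sub
    with Finₚ.any? (λ x → adj? a x ×-dec ¬? (x ≟ b))
  ... | no none = leaf only
    where
    only : ∀ x → a ~ x → x ≡ b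
    only x ax with x ≟ b
    ... | yes p = p
    ... | no  p = ⊥-elim (none (x , ax , p))
  ... | yes (a′ , aa′ , a′≢b)
    with Finₚ.any? (λ x → adj? a x ×-dec (¬? (x ≟ b) ×-dec ¬? (x ≟ a′)))
  ... | yes (y , ay , y≢b , y≢a′) = fork aa′ ay a′≢b y≢b (≢-sym y≢a′)
  ... | no  none = shorter f l≤f
    where
    only : ∀ x → a ~ x → x ≡ b ⊎ x ≡ a′
    only x ax with x ≟ b | x ≟ a′
    ... | yes p | _     = inj₁ p
    ... | no  _ | yes q = inj₂ q
    ... | no  p | no  q = ⊥-elim (none (x , ax , p , q))
    l-shrinks : length (delete a l) < length l
    l-shrinks = length-delete-< a (sub ε)
    shorter : ∀ f → length l ≤ f → Arm b a
    shorter zero    l≤0 = ⊥-elim (ℕₚ.n≮0 (ℕₚ.≤-trans l-shrinks l≤0))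
    shorter (suc f) l≤f = pass aa′ a′≢b only
      (arm-within f (delete a l) (s≤s⁻¹ (ℕₚ.≤-trans l-shrinks l≤f)) (~-sym aa′)
        λ s → ∈-delete a (sub (lift-side ab aa′ a′≢b s)) (side-≢ (~⇒≢ (~-sym aa′)) s))

  arm : ∀ {a b} → a ~ b → Arm b a
  arm ab = arm-within _ (allFin n) ℕₚ.≤-refl ab (λ {u} _ → ∈-allFin u)

  -- A fork at the end counts, a leaf does not: only vertices of degree other than 1 can belong to a
  -- trail.
  inner : ∀ {b a} → Arm b a → List V
  inner         (leaf _)         = []
  inner {a = a} (fork _ _ _ _ _) = a ∷ []
  inner {a = a} (pass _ _ _ r)   = a ∷ inner r

  -- The condition for putting `x` in front of a trail: if `y` thereby becomes an inner vertex, it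
  -- must have degree 2, and the trail must not turn back. Being local, it is inherited by every
  -- initial segment.
  Extends : V → List V → Set
  Extends x []          = ⊤
  Extends x (y ∷ [])    = x ~ y
  Extends x (y ∷ z ∷ _) = x ~ y × x ≢ z × Degree2 X y

  Trail : List V → Set
  Trail []      = ⊤
  Trail (x ∷ l) = ¬ Degree1 X x × Extends x l × Trail l

  extends-adj : ∀ {x y} l → Extends x (y ∷ l) → x ~ y
  extends-adj []      e       = e
  extends-adj (_ ∷ _) (e , _) = e

  HeadIs : V → List V → Set
  HeadIs x []      = ⊤
  HeadIs x (y ∷ _) = y ≡ x

  extends-cons : ∀ {x y z} l → HeadIs z l → x ~ y → x ≢ z → Degree2 X y → Extends x (y ∷ l)
  extends-cons []      _    xy _   _  = xy
  extends-cons (_ ∷ _) refl xy x≢z d2 = xy , x≢z , d2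

  head-inner : ∀ {b a} (r : Arm b a) → HeadIs a (inner r)
  head-inner (leaf _)         = tt
  head-inner (fork _ _ _ _ _) = refl
  head-inner (pass _ _ _ _)   = refl

  inner-trail : ∀ {b a} → b ~ a → (r : Arm b a) → Trail (inner r) × Extends b (inner r)
  inner-trail ba (leaf _)              = tt , tt
  inner-trail ba (fork ax ay _ _ x≢y)  = (two-neighbours ax ay x≢y , tt , tt) , ba
  inner-trail ba (pass aa′ a′≢b only r) with inner-trail aa′ r
  ... | t , e = (two-neighbours aa′ (~-sym ba) a′≢b , e , t)
              , extends-cons (inner r) (head-inner r) ba (≢-sym a′≢b)
                  (_ , _ , ≢-sym a′≢b , ~-sym ba , aa′ , only)

  infixr 5 _onto_
  -- Puts the inner vertices in reverse order before `l`, so that the two arms of an edge join into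
  -- one trail through that edge.
  _onto_ : ∀ {b a} → Arm b a → List V → List V
  _onto_         (leaf _)         l = l
  _onto_ {a = a} (fork _ _ _ _ _) l = a ∷ l
  _onto_ {a = a} (pass _ _ _ r)   l = r onto (a ∷ l)

  length-onto : ∀ {b a} (r : Arm b a) l → length (r onto l) ≡ length (inner r) + length l
  length-onto (leaf _)         l = refl
  length-onto (fork _ _ _ _ _) l = refl
  length-onto {a = a} (pass _ _ _ r) l =
    trans (length-onto r (a ∷ l)) (ℕₚ.+-suc (length (inner r)) (length l))

  onto-trail : ∀ {b a} → a ~ b → (r : Arm b a) → ∀ l → HeadIs b l → Trail l → Extends a l
    → Trail (r onto l)
  onto-trail ab (leaf _)                 l h t e = t
  onto-trail ab (fork ax ay _ _ x≢y)     l h t e = two-neighbours ax ay x≢y , e , t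
  onto-trail {a = a} ab (pass aa′ a′≢b only r) l h t e =
    onto-trail (~-sym aa′) r (a ∷ l) refl (two-neighbours aa′ ab a′≢b , e , t)
      (extends-cons l h (~-sym aa′) a′≢b (_ , _ , ≢-sym a′≢b , ab , aa′ , only))

  trail-side : ∀ {y z} l → Trail (z ∷ l) → All (_≢ y) (z ∷ l) → All (Side z y) (z ∷ l)
  trail-side []      _           _           = ε ∷ []
  trail-side (w ∷ l) (_ , e , t) (z≢y ∷ w≢y ∷ av) =
    ε ∷ All.map (λ s → s ◅◅ ((~-sym (extends-adj l e) , w≢y , z≢y) ◅ ε)) (trail-side l t (w≢y ∷ av))

  -- In a tree it suffices not to turn back: a second visit to `x` would lie in the branch of `z` at
  -- `y`, whereas `x` is the root of another branch there.
  trail-unique : ∀ l → Trail l → Unique l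
  trail-unique []                _                         = []
  trail-unique (x ∷ [])          _                         = [] ∷ []
  trail-unique (x ∷ y ∷ [])      (_ , xy , _)              = (~⇒≢ xy ∷ []) ∷ [] ∷ []
  trail-unique (x ∷ y ∷ z ∷ l)   (_ , (xy , x≢z , _) , t@(_ , e , t′)) with trail-unique (y ∷ z ∷ l) t
  ... | y∉ ∷ u = (~⇒≢ xy ∷ All.map new (trail-side l t′ (All.map ≢-sym y∉))) ∷ y∉ ∷ u
    where
    new : ∀ {w} → Side z y w → x ≢ w
    new s refl = branches-disjoint (~-sym xy) (extends-adj l e) x≢z s

  trail-adj : ∀ l → Trail l → ∀ {m} (h : suc m ≤ length l) (i : Fin m)
    → lookup l (inject≤ (inject₁ i) h) ~ lookup l (inject≤ (suc i) h)
  trail-adj (x ∷ y ∷ l) (_ , e , _) h zero    = extends-adj l e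
  trail-adj (x ∷ y ∷ l) (_ , _ , t) h (suc i) = trail-adj (y ∷ l) t (s≤s⁻¹ h) i
  trail-adj (x ∷ [])    _ (s≤s ()) zero
  trail-adj (x ∷ [])    _ (s≤s ()) (suc i)

  trail-degree2 : ∀ l → Trail l → ∀ {m} (h : suc (suc m) ≤ length l) (i : Fin m)
    → Degree2 X (lookup l (inject≤ (suc (inject₁ i)) h))
  trail-degree2 (x ∷ y ∷ z ∷ l) (_ , (_ , _ , d2) , _) h zero = d2
  trail-degree2 (x ∷ y ∷ z ∷ l) (_ , _ , t) h (suc i) = trail-degree2 (y ∷ z ∷ l) t (s≤s⁻¹ h) i
  trail-degree2 (x ∷ y ∷ []) _ (s≤s (s≤s ())) zero
  trail-degree2 (x ∷ y ∷ []) _ (s≤s (s≤s ())) (suc i)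
  trail-degree2 (x ∷ []) _ (s≤s ())

  trail-nonleaf : ∀ l → Trail l → All (λ v → ¬ Degree1 X v) l
  trail-nonleaf []      _           = []
  trail-nonleaf (x ∷ l) (d , _ , t) = d ∷ trail-nonleaf l t

  -- The first `m` vertices form the bridge: every edge of a tree is a cut-edge, and no vertex of a
  -- trail is a leaf.
  trail-bridge : ∀ {m} l → Trail l → 2 ≤ m → m ≤ length l → HasBridge X m
  trail-bridge {suc (suc m)} l t (s≤s (s≤s _)) h =
    (λ i → lookup l (inject≤ i h))
    , (λ e → Finₚ.inject≤-injective h h _ _ (lookup-injective l (trail-unique l t) e))
    , (λ i → tree-edge-cut (trail-adj l t h i))
    , trail-degree2 l t h
    , All.lookup (trail-nonleaf l t) (∈-lookup (inject≤ zero h))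
    , All.lookup (trail-nonleaf l t) (∈-lookup (inject≤ (fromℕ (suc m)) h))

  -- The two arms of `ab` join into a trail of the total length, which with `m` or more vertices
  -- would contain an `m`-bridge.
  inner-bound : ∀ {m a b} → 2 ≤ m → ¬ HasBridge X m → a ~ b → (rᵃ : Arm b a) (rᵇ : Arm a b)
    → length (inner rᵃ) + length (inner rᵇ) < m
  inner-bound {m} {a} {b} 2≤m nb ab rᵃ rᵇ with inner-trail ab rᵇ
  ... | t , e = ℕₚ.≰⇒> λ m≤ → nb (trail-bridge (rᵃ onto inner rᵇ)
    (onto-trail ab rᵃ (inner rᵇ) (head-inner rᵇ) t e) 2≤m
    (ℕₚ.≤-trans m≤ (ℕₚ.≤-reflexive (sym (length-onto rᵃ (inner rᵇ))))))

  -- Routes to a fork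

  -- Unlike an arm, a route to a fork may pass through vertices of any degree; p at a and q at b
  -- can follow it as soon as all its targets are vacated.
  data Route (b a : V) : Set where
    fork : ∀ x y → a ~ x → a ~ y → x ≢ b → y ≢ b → x ≢ y → Route b a
    step : ∀ a′ → a ~ a′ → a′ ≢ b → Route a a′ → Route b a

  targets : ∀ {b a} → Route b a → List V
  targets (fork x y _ _ _ _ _) = x ∷ y ∷ []
  targets (step a′ _ _ r)      = a′ ∷ targets r

  targets-side : ∀ {b a} → a ~ b → (r : Route b a) → All (λ t → Side a b t × t ≢ a) (targets r)
  targets-side ab (fork x y ax ay x≢b y≢b x≢y) =
      (lift-side ab ax x≢b ε , ~⇒≢ (~-sym ax))
    ∷ (lift-side ab ay y≢b ε , ~⇒≢ (~-sym ay)) ∷ []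
  targets-side ab (step a′ aa′ a′≢b r) =
      (lift-side ab aa′ a′≢b ε , ~⇒≢ (~-sym aa′))
    ∷ All.map (λ (s , _) → lift-side ab aa′ a′≢b s , side-≢ (~⇒≢ (~-sym aa′)) s)
        (targets-side (~-sym aa′) r)

  -- Constrains only the first step, to force every hole behind `a` to lie in the branch of `a′`.
  Funnel : ∀ {b a} → Route b a → Set
  Funnel         (fork _ _ _ _ _ _ _) = ⊤
  Funnel {b} {a} (step a′ _ _ _)      = ∀ {u} → Side a b u → u ≢ a → Side a′ a u

  Behind : V → V → V → Set
  Behind a b u = Side a b u × u ≢ a

  -- An arm that ends in a leaf makes up its whole side, which bounds the room there. One that ends
  -- in a fork gives a route whose targets are the inner vertices after `a` and two further
  -- neighbours of the fork, hence the `suc`.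
  arm-end : ∀ {b a} → a ~ b → (r : Arm b a)
    → (∀ {U} → Unique U → All (Behind a b) U → length U ≤ length (inner r))
    ⊎ Σ (Route b a) λ s → Funnel s × length (targets s) ≡ suc (length (inner r))
  arm-end {b} {a} ab (leaf only) = inj₁ bound
    where
    bound : ∀ {U} → Unique U → All (Behind a b) U → length U ≤ 0
    bound _ [] = z≤n
    bound _ ((s , u≢a) ∷ _) with descend s
    ... | inj₁ u≡a                 = ⊥-elim (u≢a u≡a)
    ... | inj₂ (a′ , aa′ , a′≢b , _) = ⊥-elim (a′≢b (only a′ aa′))
  arm-end ab (fork {x} {y} ax ay x≢b y≢b x≢y) = inj₂ (fork x y ax ay x≢b y≢b x≢y , tt , refl)
  arm-end {b} {a} ab (pass {a′} aa′ a′≢b only r) = extend (arm-end (~-sym aa′) r)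
    where
    next : ∀ {u} → Side a b u → u ≢ a → Side a′ a u
    next s u≢a with descend s
    ... | inj₁ u≡a = ⊥-elim (u≢a u≡a)
    ... | inj₂ (a″ , aa″ , a″≢b , s′) with only a″ aa″
    ...   | inj₁ a″≡b = ⊥-elim (a″≢b a″≡b)
    ...   | inj₂ refl = s′
    behind : ∀ {U x} → All (Behind a b) U → x ∈ U × x ≢ a′ → Behind a′ a x
    behind al (x∈ , x≢) with All.lookup al x∈
    ... | s , x≢a = next s x≢a , x≢
    extend : (∀ {U} → Unique U → All (Behind a′ a) U → length U ≤ length (inner r))
      ⊎ (Σ (Route a a′) λ s → Funnel s × length (targets s) ≡ suc (length (inner r)))
      → (∀ {U} → Unique U → All (Behind a b) U → length U ≤ suc (length (inner r)))
      ⊎ Σ (Route b a) λ s → Funnel s × length (targets s) ≡ suc (suc (length (inner r)))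
    extend (inj₂ (s , _ , eq)) = inj₂ (step a′ aa′ a′≢b s , next , cong suc eq)
    -- Of the vertices behind `a`, only `a′` itself is not behind `a′`.
    extend (inj₁ bound) = inj₁ λ {U} u al → ℕₚ.≤-trans (length-delete a′ u)
      (s≤s (bound (delete-unique a′ u) (All.tabulate λ x∈ → behind al (delete-⊆ a′ {l = U} x∈))))

  many-behind : ∀ {b a} → a ~ b → (r : Arm b a) → ∀ {U} → Unique U → All (Behind a b) U
    → length (inner r) < length U
    → Σ (Route b a) λ s → Funnel s × length (targets s) ≤ length U
  many-behind ab r u al lt with arm-end ab r
  ... | inj₁ bound          = ⊥-elim (ℕₚ.<⇒≱ lt (bound u al))
  ... | inj₂ (s , f , eq) = s , f , ℕₚ.≤-trans (ℕₚ.≤-reflexive eq) lt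

-- Configurations and walks in the friends-and-strangers graph

module Configurations {n : ℕ} (X : Graph (Fin n)) {t : ℕ} (k : Fin t → ℕ) where

  B : Set
  B = Σ (Fin t) λ i → Fin (k i)

  Conf : Set
  Conf = Fin n ↔ B

  colour : B → Fin t
  colour = proj₁

  infixl 6 _∙_
  _∙_ : Conf → Fin n → B
  _∙_ = Inverse.to

  ∙-injective : ∀ σ {x y} → σ ∙ x ≡ σ ∙ y → x ≡ y
  ∙-injective σ = Injection.injective (↔⇒↣ σ)

  position : ∀ (σ : Conf) r → Σ (Fin n) λ u → σ ∙ u ≡ r
  position σ r = Inverse.from σ r , Inverse.inverseˡ σ refl

  transpose-left : ∀ (a b : Fin n) → PC.transpose a b a ≡ b
  transpose-left a b rewrite dec-true (a Finₚ.≟ a) refl = refl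

  transpose-right : ∀ (a b : Fin n) → PC.transpose a b b ≡ a
  transpose-right a b with b Finₚ.≟ a
  ... | yes b≡a = b≡a
  ... | no  _ rewrite dec-true (b Finₚ.≟ b) refl = refl

  transpose-other : ∀ {a b c : Fin n} → c ≢ a → c ≢ b → PC.transpose a b c ≡ c
  transpose-other {a} {b} {c} c≢a c≢b
    rewrite dec-false (c Finₚ.≟ a) c≢a | dec-false (c Finₚ.≟ b) c≢b = refl

  -- Kept opaque, so that all later reasoning about `swap` goes through the three equations.
  abstract
    swap : Conf → Fin n → Fin n → Conf
    swap σ a b = σ ↔-∘ transpose a b

    swap-left : ∀ σ a b → swap σ a b ∙ a ≡ σ ∙ b
    swap-left σ a b = cong (σ ∙_) (transpose-left a b)

    swap-right : ∀ σ a b → swap σ a b ∙ b ≡ σ ∙ a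
    swap-right σ a b = cong (σ ∙_) (transpose-right a b)

    swap-other : ∀ σ {a b c} → c ≢ a → c ≢ b → swap σ a b ∙ c ≡ σ ∙ c
    swap-other σ c≢a c≢b = cong (σ ∙_) (transpose-other c≢a c≢b)

  infix 4 _≗_ _⇝_
  _≗_ : Conf → Conf → Set
  σ ≗ τ = ∀ a → σ ∙ a ≡ τ ∙ a

  Move : Conf → Conf → Set
  Move = FSAdj X (CompleteMultipartite t k)

  -- Bijections with equal values need not be equal as terms, so a walk may end at any bijection
  -- that agrees pointwise with `τ`, as in `FSConnected`.
  record _⇝_ (σ τ : Conf) : Set where
    constructor reach
    field
      end   : Conf
      walk  : Star Move σ end
      agree : end ≗ τ

  ≗-resp-move : ∀ σ σ′ τ → σ ≗ σ′ → Move σ′ τ → Move σ τ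
  ≗-resp-move σ σ′ τ σ≗ (a , b , ab , ne , ga , gb , go) =
    a , b , ab , (λ e → ne (trans (cong colour (sym (σ≗ a))) (trans e (cong colour (σ≗ b)))))
    , trans ga (sym (σ≗ b)) , trans gb (sym (σ≗ a))
    , λ c c≢a c≢b → trans (go c c≢a c≢b) (sym (σ≗ c))

  move-sym : ∀ σ τ → Move σ τ → Move τ σ
  move-sym σ τ (a , b , ab , ne , ga , gb , go) =
    a , b , ab , (λ e → ne (trans (cong colour (sym gb)) (trans (sym e) (cong colour ga))))
    , sym gb , sym ga , λ c c≢a c≢b → sym (go c c≢a c≢b)

  ≗⇒⇝ : ∀ {σ τ} → σ ≗ τ → σ ⇝ τ
  ≗⇒⇝ e = reach _ ε e

  ⇝-refl : ∀ {σ} → σ ⇝ σ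
  ⇝-refl = reach _ ε λ _ → refl

  ⇝-trans : ∀ {σ τ υ} → σ ⇝ τ → τ ⇝ υ → σ ⇝ υ
  ⇝-trans (reach _ w e) (reach _ ε e′)        = reach _ w λ a → trans (e a) (e′ a)
  ⇝-trans {τ = τ} (reach ρ w e) (reach _ (_◅_ {j = τ′} m w′) e′) = reach _ (w ◅◅ (≗-resp-move ρ τ τ′ e m ◅ w′)) e′

  ⇝-sym : ∀ {σ τ} → σ ⇝ τ → τ ⇝ σ
  ⇝-sym (reach _ w e) = ⇝-trans (≗⇒⇝ λ a → sym (e a)) (reach _ (reverse (λ {σ} {τ} → move-sym σ τ) w) λ _ → refl)

  move : ∀ σ {a b} → Adj X a b → colour (σ ∙ a) ≢ colour (σ ∙ b) → σ ⇝ swap σ a b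
  move σ {a} {b} ab ne = reach (swap σ a b)
    (_◅_ {j = swap σ a b} (a , b , ab , ne , swap-left σ a b , swap-right σ a b
      , λ _ c≢a c≢b → swap-other σ c≢a c≢b) ε) λ _ → refl

  -- A colour-preserving permutation of the labels is an automorphism of the complete multipartite
  -- graph, so it acts on walks.
  relabel : ∀ (π : B ↔ B) → (∀ r → colour (Inverse.to π r) ≡ colour r)
    → ∀ {σ τ} → σ ⇝ τ → (π ↔-∘ σ) ⇝ (π ↔-∘ τ)
  relabel π pc (reach _ w e) = reach _ (go w) λ a → cong (Inverse.to π) (e a)
    where
    go : ∀ {σ ρ} → Star Move σ ρ → Star Move (π ↔-∘ σ) (π ↔-∘ ρ)
    go ε = ε
    go ((a , b , ab , ne , ga , gb , o) ◅ w) =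
      (a , b , ab , (λ e → ne (trans (sym (pc _)) (trans e (pc _))))
      , cong (Inverse.to π) ga , cong (Inverse.to π) gb
      , λ c c≢a c≢b → cong (Inverse.to π) (o c c≢a c≢b)) ◅ go w

  -- Along a walk in `X`, a transposition of distant vertices is obtained by conjugation with edge
  -- swaps; then the labels of `τ` are put in place vertex by vertex.
  edge-swaps-suffice : Connected X → (∀ σ {a b} → Adj X a b → σ ⇝ swap σ a b)
    → ∀ σ τ → σ ⇝ τ
  edge-swaps-suffice conn edge σ τ with agree (allFin n)
    where
    any-swap : ∀ {a b} → Star (Adj X) a b → a ≢ b → ∀ σ → σ ⇝ swap σ a b
    any-swap ε a≢b σ = ⊥-elim (a≢b refl)
    any-swap {a} {b} (_◅_ {j = z} e w) a≢b σ with z Finₚ.≟ b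
    ... | yes refl = edge σ e
    ... | no  z≢b  = ⇝-trans (edge σ e) (⇝-trans (any-swap w z≢b σ₁) (⇝-trans (edge σ₂ e) (≗⇒⇝ conj)))
      where
      σ₁ σ₂ : Conf
      σ₁ = swap σ a z
      σ₂ = swap σ₁ z b
      a≢z : a ≢ z
      a≢z refl = irrefl X e
      conj : swap σ₂ a z ≗ swap σ a b
      conj c with c Finₚ.≟ a
      ... | yes refl = trans (swap-left σ₂ a z) (trans (swap-left σ₁ z b)
                         (trans (swap-other σ (≢-sym a≢b) (≢-sym z≢b)) (sym (swap-left σ a b))))
      ... | no  c≢a with c Finₚ.≟ z
      ...   | yes refl = trans (swap-right σ₂ a c) (trans (swap-other σ₁ a≢z a≢b)
                           (trans (swap-left σ a c) (sym (swap-other σ c≢a z≢b))))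
      ...   | no  c≢z with c Finₚ.≟ b
      ...     | yes refl = trans (swap-other σ₂ c≢a c≢z) (trans (swap-right σ₁ z c)
                             (trans (swap-right σ a z) (sym (swap-right σ a c))))
      ...     | no  c≢b = trans (swap-other σ₂ c≢a c≢z) (trans (swap-other σ₁ c≢z c≢b)
                            (trans (swap-other σ c≢a c≢z) (sym (swap-other σ c≢a c≢b))))
    agree : ∀ l → Σ Conf λ ρ → σ ⇝ ρ × (∀ {d} → d ∈ l → ρ ∙ d ≡ τ ∙ d)
    agree [] = σ , ⇝-refl , λ ()
    agree (d ∷ l) with agree l
    ... | ρ , σ⇝ρ , ok with position ρ (τ ∙ d)
    ...   | u , ρu with u Finₚ.≟ d
    ...     | yes refl = ρ , σ⇝ρ , λ { (here refl) → ρu ; (there d∈) → ok d∈ }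
    ...     | no  u≢d  = swap ρ u d , ⇝-trans σ⇝ρ (any-swap (conn u d) u≢d ρ) , ok′
      where
      ok′ : ∀ {e} → e ∈ d ∷ l → swap ρ u d ∙ e ≡ τ ∙ e
      ok′ (here refl) = trans (swap-right ρ u d) ρu
      ok′ {e} (there e∈) with e Finₚ.≟ d
      ... | yes refl = trans (swap-right ρ u d) ρu
      ... | no  e≢d  = trans (swap-other ρ e≢u e≢d) (ok e∈)
        where
        e≢u : e ≢ u
        e≢u refl = e≢d (∙-injective τ (trans (sym (ok e∈)) ρu))
  ... | ρ , r , ok = ⇝-trans r (≗⇒⇝ λ a → ok (∈-allFin a))

ThirdColour : (t : ℕ) → (Fin t → ℕ) → Set
ThirdColour t k = ∀ i j → Σ (Σ (Fin t) λ i → Fin (k i)) λ r → proj₁ r ≢ i × proj₁ r ≢ j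

-- Exchanging two labels of one colour

module Exchange {n : ℕ} (X : Graph (Fin n)) (conn : Connected X) (acyclic : ¬ HasCycle X)
  {t : ℕ} (k : Fin t → ℕ) (third : ThirdColour t k) (c : Fin t)
  (π : (Σ (Fin t) λ i → Fin (k i)) ↔ (Σ (Fin t) λ i → Fin (k i)))
  (π-colour : ∀ r → proj₁ (Inverse.to π r) ≡ proj₁ r) where

  open Tree X conn acyclic
  open Configurations X k

  -- Vertices whose label is not of colour c act as holes for the labels of colour c.
  Hole : Conf → V → Set
  Hole σ u = colour (σ ∙ u) ≢ c

  hole? : ∀ σ u → Dec (Hole σ u)
  hole? σ u = ¬? (colour (σ ∙ u) Finₚ.≟ c)

  pebble : ∀ σ {u} → ¬ Hole σ u → colour (σ ∙ u) ≡ c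
  pebble σ {u} ¬h with colour (σ ∙ u) Finₚ.≟ c
  ... | yes p = p
  ... | no  h = ⊥-elim (¬h h)

  hole-≡ : ∀ σ τ {u w} → τ ∙ w ≡ σ ∙ u → Hole σ u → Hole τ w
  hole-≡ σ τ e h p = h (trans (cong colour (sym e)) p)

  colour-≢ : ∀ σ {u w} → colour (σ ∙ u) ≢ colour (σ ∙ w) → u ≢ w
  colour-≢ σ ne refl = ne refl

  -- `π` is the transposition of `p` and `q`. A permutation of labels, unlike one of positions,
  -- makes sense wherever the two labels stand, so that exchangeability can be carried along walks.
  record Twins (p q : B) : Set where
    field
      colourˡ : colour p ≡ c
      colourʳ : colour q ≡ c
      π-left  : Inverse.to π p ≡ q
      π-right : Inverse.to π q ≡ p
      π-other : ∀ r → r ≢ p → r ≢ q → Inverse.to π r ≡ r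
  open Twins

  twins-sym : ∀ {p q} → Twins p q → Twins q p
  twins-sym T = record
    { colourˡ = colourʳ T ; colourʳ = colourˡ T ; π-left = π-right T ; π-right = π-left T
    ; π-other = λ r r≢q r≢p → π-other T r r≢p r≢q }

  Exchangeable : Conf → Set
  Exchangeable σ = σ ⇝ (π ↔-∘ σ)

  -- π preserves colours, so it carries walks in the friends-and-strangers graph to walks.
  pull-back : ∀ {σ τ} → σ ⇝ τ → Exchangeable τ → Exchangeable σ
  pull-back r x = ⇝-trans r (⇝-trans x (⇝-sym (relabel π π-colour r)))

  hole-move : ∀ σ {a b} → a ~ b → Hole σ a → ¬ Hole σ b → σ ⇝ swap σ a b
  hole-move σ ab h ¬h = move σ ab λ e → h (trans e (pebble σ ¬h))

  -- Exchange inside a star with three leaves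

  module FourStar {v x y w} (vx : v ~ x) (vy : v ~ y) (vw : v ~ w)
    (x≢y : x ≢ y) (x≢w : x ≢ w) (y≢w : y ≢ w) (σ₀ : Conf) where

    -- Indexing by the labels on the star lets a sequence of moves be read as a computation on these
    -- four labels.
    record At (l₀ l₁ l₂ l₃ : B) : Set where
      field
        conf  : Conf
        route : σ₀ ⇝ conf
        at-v  : conf ∙ v ≡ l₀
        at-x  : conf ∙ x ≡ l₁
        at-y  : conf ∙ y ≡ l₂
        at-w  : conf ∙ w ≡ l₃
        off   : ∀ {u} → u ≢ v → u ≢ x → u ≢ y → u ≢ w → conf ∙ u ≡ σ₀ ∙ u
    open At

    via : ∀ {u} τ → v ~ u → σ₀ ⇝ τ → ∀ {l l′} → τ ∙ v ≡ l → τ ∙ u ≡ l′ → colour l ≢ colour l′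
      → σ₀ ⇝ swap τ v u
    via τ vu r refl refl ne = ⇝-trans r (move τ vu ne)

    step-x : ∀ {l₀ l₁ l₂ l₃} → colour l₀ ≢ colour l₁ → At l₀ l₁ l₂ l₃ → At l₁ l₀ l₂ l₃
    step-x ne A = record
      { conf = swap τ v x ; route = via τ vx (route A) (at-v A) (at-x A) ne
      ; at-v = trans (swap-left τ v x) (at-x A)
      ; at-x = trans (swap-right τ v x) (at-v A)
      ; at-y = trans (swap-other τ (≢-sym (~⇒≢ vy)) (≢-sym x≢y)) (at-y A)
      ; at-w = trans (swap-other τ (≢-sym (~⇒≢ vw)) (≢-sym x≢w)) (at-w A)
      ; off  = λ ≢v ≢x ≢y ≢w → trans (swap-other τ ≢v ≢x) (off A ≢v ≢x ≢y ≢w) }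
      where τ = conf A

    step-y : ∀ {l₀ l₁ l₂ l₃} → colour l₀ ≢ colour l₂ → At l₀ l₁ l₂ l₃ → At l₂ l₁ l₀ l₃
    step-y ne A = record
      { conf = swap τ v y ; route = via τ vy (route A) (at-v A) (at-y A) ne
      ; at-v = trans (swap-left τ v y) (at-y A)
      ; at-x = trans (swap-other τ (≢-sym (~⇒≢ vx)) x≢y) (at-x A)
      ; at-y = trans (swap-right τ v y) (at-v A)
      ; at-w = trans (swap-other τ (≢-sym (~⇒≢ vw)) (≢-sym y≢w)) (at-w A)
      ; off  = λ ≢v ≢x ≢y ≢w → trans (swap-other τ ≢v ≢y) (off A ≢v ≢x ≢y ≢w) }
      where τ = conf A

    step-w : ∀ {l₀ l₁ l₂ l₃} → colour l₀ ≢ colour l₃ → At l₀ l₁ l₂ l₃ → At l₃ l₁ l₂ l₀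
    step-w ne A = record
      { conf = swap τ v w ; route = via τ vw (route A) (at-v A) (at-w A) ne
      ; at-v = trans (swap-left τ v w) (at-w A)
      ; at-x = trans (swap-other τ (≢-sym (~⇒≢ vx)) x≢w) (at-x A)
      ; at-y = trans (swap-other τ (≢-sym (~⇒≢ vy)) y≢w) (at-y A)
      ; at-w = trans (swap-right τ v w) (at-v A)
      ; off  = λ ≢v ≢x ≢y ≢w → trans (swap-other τ ≢v ≢w) (off A ≢v ≢x ≢y ≢w) }
      where τ = conf A

  -- Only `p` and `q` may not be swapped directly. The distinct colours of the holes enter in the
  -- third move, where the holes pass each other.
  exchange-two-colours : ∀ {v x y w} → v ~ x → v ~ y → v ~ w → x ≢ y → x ≢ w → y ≢ w
    → ∀ {p q} → Twins p q → ∀ σ → σ ∙ x ≡ p → σ ∙ y ≡ q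
    → Hole σ v → Hole σ w → colour (σ ∙ v) ≢ colour (σ ∙ w) → Exchangeable σ
  exchange-two-colours {v} {x} {y} {w} vx vy vw x≢y x≢w y≢w {p} {q} T σ σx σy hv hw ne =
    ⇝-trans (route end) (≗⇒⇝ same)
    where
    open FourStar vx vy vw x≢y x≢w y≢w σ
    open At
    v≢p : colour (σ ∙ v) ≢ colour p
    v≢p e = hv (trans e (colourˡ T))
    v≢q : colour (σ ∙ v) ≢ colour q
    v≢q e = hv (trans e (colourʳ T))
    w≢p : colour (σ ∙ w) ≢ colour p
    w≢p e = hw (trans e (colourˡ T))
    w≢q : colour (σ ∙ w) ≢ colour q
    w≢q e = hw (trans e (colourʳ T))
    start : At (σ ∙ v) p q (σ ∙ w)
    start = record { conf = σ ; route = ⇝-refl ; at-v = refl ; at-x = σx ; at-y = σy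
                   ; at-w = refl ; off = λ _ _ _ _ → refl }
    -- A shortest solution of the four-vertex star, found by breadth-first search.
    end : At (σ ∙ v) q p (σ ∙ w)
    end = step-y (≢-sym v≢p) (step-w w≢p (step-x (≢-sym w≢q) (step-y v≢q
          (step-x (≢-sym ne) (step-w (≢-sym w≢p) (step-x v≢p start))))))
    same : conf end ≗ (π ↔-∘ σ)
    same u with u ≟ v
    ... | yes refl = trans (at-v end) (sym (π-other T _ (v≢p ∘ cong colour) (v≢q ∘ cong colour)))
    ... | no  u≢v with u ≟ x
    ...   | yes refl = trans (at-x end) (sym (trans (cong (Inverse.to π) σx) (π-left T)))
    ...   | no  u≢x with u ≟ y
    ...     | yes refl = trans (at-y end) (sym (trans (cong (Inverse.to π) σy) (π-right T)))
    ...     | no  u≢y with u ≟ w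
    ...       | yes refl = trans (at-w end) (sym (π-other T _ (w≢p ∘ cong colour) (w≢q ∘ cong colour)))
    ...       | no  u≢w = trans (off end u≢v u≢x u≢y u≢w) (sym (π-other T _
                  (λ e → u≢x (∙-injective σ (trans e (sym σx))))
                  (λ e → u≢y (∙-injective σ (trans e (sym σy))))))

  move-labels : ∀ σ {a b l l′} → a ~ b → σ ∙ a ≡ l → σ ∙ b ≡ l′ → colour l ≢ colour l′
    → σ ⇝ swap σ a b
  move-labels σ ab refl refl ne = move σ ab ne

  labels-≢ : ∀ σ {a b l l′} → σ ∙ a ≡ l → σ ∙ b ≡ l′ → colour l ≢ colour l′
    → colour (σ ∙ a) ≢ colour (σ ∙ b)
  labels-≢ σ refl refl ne = ne

  twin-≢ : ∀ {p q} → Twins p q → ∀ σ {u w} → σ ∙ w ≡ p → Hole σ u → u ≢ w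
  twin-≢ T σ σw hu refl = hu (trans (cong colour σw) (colourˡ T))

  -- The label `r` steps aside to `u`, the other two labels pass each other on the edge between `ℓ`
  -- and `v`, and `r` returns.
  detour : ∀ {v u ℓ r} → v ~ ℓ → ℓ ~ u → v ≢ u → ∀ σ → σ ∙ ℓ ≡ r
    → colour (σ ∙ u) ≢ colour r → colour (σ ∙ v) ≢ colour r → colour (σ ∙ u) ≢ colour (σ ∙ v)
    → Σ Conf λ τ → σ ⇝ τ × τ ∙ ℓ ≡ r × τ ∙ v ≡ σ ∙ u
      × (∀ {w} → w ≢ u → w ≢ v → w ≢ ℓ → τ ∙ w ≡ σ ∙ w)
  detour {v} {u} {ℓ} {r} vℓ ℓu v≢u σ σℓ u≢r v≢r u≢v-col = σ₃
    , ⇝-trans (move-labels σ (~-sym ℓu) refl σℓ u≢r)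
        (⇝-trans (move-labels σ₁ (~-sym vℓ) (swap-right σ u ℓ) (swap-other σ v≢u v≢ℓ) u≢v-col)
          (move-labels σ₂ (~-sym ℓu) σ₂u σ₂ℓ (≢-sym v≢r)))
    , trans (swap-right σ₂ u ℓ) σ₂u
    , trans (swap-other σ₂ v≢u v≢ℓ) (trans (swap-right σ₁ ℓ v) (swap-right σ u ℓ))
    , λ w≢u w≢v w≢ℓ → trans (swap-other σ₂ w≢u w≢ℓ) (trans (swap-other σ₁ w≢ℓ w≢v) (swap-other σ w≢u w≢ℓ))
    where
    σ₁ σ₂ σ₃ : Conf
    σ₁ = swap σ u ℓ
    σ₂ = swap σ₁ ℓ v
    σ₃ = swap σ₂ u ℓ
    v≢ℓ : v ≢ ℓ
    v≢ℓ = ~⇒≢ vℓ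
    u≢ℓ : u ≢ ℓ
    u≢ℓ = ~⇒≢ (~-sym ℓu)
    σ₂u : σ₂ ∙ u ≡ r
    σ₂u = trans (swap-other σ₁ u≢ℓ (≢-sym v≢u)) (trans (swap-left σ u ℓ) σℓ)
    σ₂ℓ : σ₂ ∙ ℓ ≡ σ ∙ v
    σ₂ℓ = trans (swap-left σ₁ ℓ v) (swap-other σ v≢u v≢ℓ)

  -- If v and w hold the same colour, a label of a third colour is first walked towards v,
  -- stepping around p or q if its branch is that of x or y.
  exchange-at-fork : ∀ {v x y w} → v ~ x → v ~ y → v ~ w → x ≢ y → x ≢ w → y ≢ w
    → ∀ {p q} → Twins p q → ∀ σ → σ ∙ x ≡ p → σ ∙ y ≡ q
    → Hole σ v → Hole σ w → Exchangeable σ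
  exchange-at-fork {v} {x} {y} {w} vx vy vw x≢y x≢w y≢w {p} {q} T σ σx σy hv hw
    with colour (σ ∙ v) Finₚ.≟ colour (σ ∙ w)
  ... | no ne = exchange-two-colours vx vy vw x≢y x≢w y≢w T σ σx σy hv hw ne
  ... | yes v≡w with third c (colour (σ ∙ v))
  ... | r , r≢c , r≢v with position σ r
  ... | u , refl with branch v u
  ... | inj₁ refl = ⊥-elim (r≢v refl)
  ... | inj₂ (u₁ , vu₁ , s) = bring vu₁ s σ σx σy hv v≡w r≢c r≢v
    where
    two : ∀ τ → τ ∙ x ≡ p → τ ∙ y ≡ q → ∀ {l l′} → τ ∙ v ≡ l → τ ∙ w ≡ l′
      → colour l ≢ c → colour l′ ≢ c → colour l ≢ colour l′ → Exchangeable τ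
    two τ τx τy refl refl = exchange-two-colours vx vy vw x≢y x≢w y≢w T τ τx τy
    hole-w : ∀ τ → Hole τ v → colour (τ ∙ v) ≡ colour (τ ∙ w) → Hole τ w
    hole-w τ hv e h = hv (trans e h)
    bring : ∀ {u u₁} → v ~ u₁ → Side u₁ v u → ∀ τ → τ ∙ x ≡ p → τ ∙ y ≡ q → Hole τ v
      → colour (τ ∙ v) ≡ colour (τ ∙ w) → Hole τ u → colour (τ ∙ u) ≢ colour (τ ∙ v)
      → Exchangeable τ
    bring {u} vu ε τ τx τy hv v≡w hu ne = pull-back (move τ vu (≢-sym ne))
      (two (swap τ v u)
        (trans (swap-other τ (≢-sym (~⇒≢ vx)) (≢-sym (twin-≢ T τ τx hu))) τx)
        (trans (swap-other τ (≢-sym (~⇒≢ vy)) (≢-sym (twin-≢ (twins-sym T) τ τy hu))) τy)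
        (swap-left τ v u) (swap-other τ (≢-sym (~⇒≢ vw)) (≢-sym (colour-≢ τ u≢w)))
        hu (hole-w τ hv v≡w) u≢w)
      where
      u≢w : colour (τ ∙ u) ≢ colour (τ ∙ w)
      u≢w e = ne (trans e (sym v≡w))
    bring {u} vu₁ (_◅_ {j = u′} (uu′ , u≠v , u′≠v) s) τ τx τy hv v≡w hu ne
      with u′ ≟ w | u′ ≟ x | u′ ≟ y | colour (τ ∙ u) Finₚ.≟ colour (τ ∙ u′)
    -- Once next to `w`, the third colour is put on `w` rather than on `v`; this too makes the
    -- colours of the two holes differ.
    ... | yes refl | _ | _ | _ = pull-back (move τ uu′ u≢w)
      (two (swap τ u w)
        (trans (swap-other τ (≢-sym (twin-≢ T τ τx hu)) x≢w) τx)
        (trans (swap-other τ (≢-sym (twin-≢ (twins-sym T) τ τy hu)) y≢w) τy)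
        (swap-other τ (≢-sym u≠v) (~⇒≢ vw)) (swap-right τ u w)
        hv hu (≢-sym ne))
      where
      u≢w : colour (τ ∙ u) ≢ colour (τ ∙ w)
      u≢w e = ne (trans e (sym v≡w))
    ... | no _ | yes refl | _ | _
      with detour vx (~-sym uu′) (≢-sym u≠v) τ τx
             (λ e → hu (trans e (colourˡ T))) (λ e → hv (trans e (colourˡ T))) ne
    ...   | τ′ , r , τ′x , τ′v , same = pull-back r
      (two τ′ τ′x (trans (same (≢-sym (twin-≢ (twins-sym T) τ τy hu)) (≢-sym (~⇒≢ vy)) (≢-sym x≢y)) τy)
        τ′v (same (λ { refl → ne (sym v≡w) }) (≢-sym (~⇒≢ vw)) (≢-sym x≢w))
        hu (hole-w τ hv v≡w) λ e → ne (trans e (sym v≡w)))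
    bring {u} vu₁ (_◅_ {j = u′} (uu′ , u≠v , u′≠v) s) τ τx τy hv v≡w hu ne
        | no _ | no _ | yes refl | _
      with detour vy (~-sym uu′) (≢-sym u≠v) τ τy
             (λ e → hu (trans e (colourʳ T))) (λ e → hv (trans e (colourʳ T))) ne
    ...   | τ′ , r , τ′y , τ′v , same = pull-back r
      (two τ′ (trans (same (≢-sym (twin-≢ T τ τx hu)) (≢-sym (~⇒≢ vx)) x≢y) τx) τ′y
        τ′v (same (λ { refl → ne (sym v≡w) }) (≢-sym (~⇒≢ vw)) (≢-sym y≢w))
        hu (hole-w τ hv v≡w) λ e → ne (trans e (sym v≡w)))
    -- Equal colours block the move, but then the label at `u′` has a suitable colour as well and
    -- takes over.
    bring {u} vu₁ (_◅_ {j = u′} (uu′ , u≠v , u′≠v) s) τ τx τy hv v≡w hu ne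
        | no _ | no _ | no _ | yes same =
      bring vu₁ s τ τx τy hv v≡w (λ e → hu (trans same e)) (λ e → ne (trans same e))
    bring {u} vu₁ (_◅_ {j = u′} (uu′ , u≠v , u′≠v) s) τ τx τy hv v≡w hu ne
        | no u′≠w | no u′≠x | no u′≠y | no u≢u′ = pull-back (move τ uu′ u≢u′)
      (bring vu₁ s τ′
        (trans (swap-other τ (≢-sym (twin-≢ T τ τx hu)) (≢-sym u′≠x)) τx)
        (trans (swap-other τ (≢-sym (twin-≢ (twins-sym T) τ τy hu)) (≢-sym u′≠y)) τy)
        (hole-≡ τ τ′ v-same hv)
        (trans (cong colour v-same) (trans v≡w (sym (cong colour w-same))))
        (hole-≡ τ τ′ (swap-right τ u u′) hu)
        (labels-≢ τ′ (swap-right τ u u′) v-same ne))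
      where
      τ′ : Conf
      τ′ = swap τ u u′
      v-same : τ′ ∙ v ≡ τ ∙ v
      v-same = swap-other τ (≢-sym u≠v) (≢-sym u′≠v)
      w-same : τ′ ∙ w ≡ τ ∙ w
      w-same = swap-other τ (λ { refl → ne (sym v≡w) }) (≢-sym u′≠w)

  -- `p` steps to `x`, `q` follows through `v` to `y`, and the two holes end on `v` and `w`.
  exchange-into-fork : ∀ {v x y w} → v ~ x → v ~ y → v ~ w → x ≢ y → x ≢ w → y ≢ w
    → ∀ {p q} → Twins p q → ∀ σ → σ ∙ v ≡ p → σ ∙ w ≡ q
    → Hole σ x → Hole σ y → Exchangeable σ
  exchange-into-fork {v} {x} {y} {w} vx vy vw x≢y x≢w y≢w {p} {q} T σ σv σw hx hy =
    pull-back (move-labels σ vx σv refl (not-p hx))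
      (pull-back (move-labels σ₁ vw σ₁v σ₁w (not-q hx ∘ sym))
        (pull-back (move-labels σ₂ vy σ₂v σ₂y (not-q hy))
          (exchange-at-fork vx vy vw x≢y x≢w y≢w T σ₃ σ₃x σ₃y
            (hole-≡ σ σ₃ σ₃v hy) (hole-≡ σ σ₃ σ₃w hx))))
    where
    not-p : ∀ {u} → Hole σ u → colour p ≢ colour (σ ∙ u)
    not-p h e = h (trans (sym e) (colourˡ T))
    not-q : ∀ {u} → Hole σ u → colour q ≢ colour (σ ∙ u)
    not-q h e = h (trans (sym e) (colourʳ T))
    σ₁ σ₂ σ₃ : Conf
    σ₁ = swap σ v x
    σ₂ = swap σ₁ v w
    σ₃ = swap σ₂ v y
    x≢v : x ≢ v
    x≢v = ~⇒≢ (~-sym vx)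
    y≢v : y ≢ v
    y≢v = ~⇒≢ (~-sym vy)
    w≢v : w ≢ v
    w≢v = ~⇒≢ (~-sym vw)
    σ₁v : σ₁ ∙ v ≡ σ ∙ x
    σ₁v = swap-left σ v x
    σ₁w : σ₁ ∙ w ≡ q
    σ₁w = trans (swap-other σ w≢v (≢-sym x≢w)) σw
    σ₂v : σ₂ ∙ v ≡ q
    σ₂v = trans (swap-left σ₁ v w) σ₁w
    σ₂y : σ₂ ∙ y ≡ σ ∙ y
    σ₂y = trans (swap-other σ₁ y≢v y≢w) (swap-other σ y≢v (≢-sym x≢y))
    σ₃x : σ₃ ∙ x ≡ p
    σ₃x = trans (swap-other σ₂ x≢v x≢y) (trans (swap-other σ₁ x≢v x≢w) (trans (swap-right σ v x) σv))
    σ₃y : σ₃ ∙ y ≡ q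
    σ₃y = trans (swap-right σ₂ v y) σ₂v
    σ₃v : σ₃ ∙ v ≡ σ ∙ y
    σ₃v = trans (swap-left σ₂ v y) σ₂y
    σ₃w : σ₃ ∙ w ≡ σ ∙ x
    σ₃w = trans (swap-other σ₂ w≢v (≢-sym y≢w)) (trans (swap-right σ₁ v w) σ₁v)

  -- Moving the pair and the holes

  -- The pair moves like a snake, and the hole of `x` reappears behind it at `b`.
  advance : ∀ {a b x} → a ~ b → a ~ x → x ≢ b → ∀ {p q} → Twins p q → ∀ σ
    → σ ∙ a ≡ p → σ ∙ b ≡ q → Hole σ x
    → Σ Conf λ τ → σ ⇝ τ × τ ∙ x ≡ p × τ ∙ a ≡ q × Hole τ b
      × (∀ {w} → w ≢ a → w ≢ b → w ≢ x → τ ∙ w ≡ σ ∙ w)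
  advance {a} {b} {x} ab ax x≢b {p} {q} T σ σa σb hx = σ₂
    , ⇝-trans (move-labels σ ax σa refl λ e → hx (trans (sym e) (colourˡ T)))
        (move-labels σ₁ ab (swap-left σ a x) σ₁b λ e → hx (trans e (colourʳ T)))
    , trans (swap-other σ₁ x≢a x≢b) (trans (swap-right σ a x) σa)
    , trans (swap-left σ₁ a b) σ₁b
    , hole-≡ σ σ₂ (trans (swap-right σ₁ a b) (swap-left σ a x)) hx
    , λ w≢a w≢b w≢x → trans (swap-other σ₁ w≢a w≢b) (swap-other σ w≢a w≢x)
    where
    σ₁ σ₂ : Conf
    σ₁ = swap σ a x
    σ₂ = swap σ₁ a b
    x≢a : x ≢ a
    x≢a = ~⇒≢ (~-sym ax)
    σ₁b : σ₁ ∙ b ≡ q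
    σ₁b = trans (swap-other σ (~⇒≢ (~-sym ab)) (≢-sym x≢b)) σb

  march : ∀ {a b} → a ~ b → (r : Route b a) → ∀ {p q} → Twins p q → ∀ σ
    → σ ∙ a ≡ p → σ ∙ b ≡ q → All (Hole σ) (targets r) → Exchangeable σ
  march ab (fork x y ax ay x≢b y≢b x≢y) T σ σa σb (hx ∷ hy ∷ []) =
    exchange-into-fork ax ay ab x≢y x≢b y≢b T σ σa σb hx hy
  march {a} {b} ab (step a′ aa′ a′≢b r) T σ σa σb (ha′ ∷ hr)
    with advance ab aa′ a′≢b T σ σa σb ha′
  ... | τ , σ⇝τ , τa′ , τa , _ , same = pull-back σ⇝τ
    (march (~-sym aa′) r T τ τa′ τa
      (All.map (λ ((s , t≢a′) , h) → hole-≡ σ τ (same (side-≢ (~⇒≢ (~-sym aa′)) s)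
          (λ { refl → branches-disjoint ab aa′ (≢-sym a′≢b) s }) t≢a′) h)
        (All.zip (targets-side (~-sym aa′) r , hr))))

  -- If the next vertex `u′` is a hole, that hole is sent on to `t` first and the one at `u` moves
  -- up when `u′` has been filled. Hence no hole other than `u` is given up.
  transfer : ∀ {b u t} σ → Star (Avoid b) u t → Hole σ u → ¬ Hole σ t
    → Σ Conf λ τ → σ ⇝ τ × Hole τ t × (∀ {w} → w ≢ u → Hole σ w → Hole τ w)
      × (∀ {w} → ¬ Star (Avoid b) w t → τ ∙ w ≡ σ ∙ w)
  transfer σ ε hu ¬ht = ⊥-elim (¬ht hu)
  transfer {b} {u} {t} σ (_◅_ {j = u′} e@(uu′ , _) s) hu ¬ht with hole? σ u′
  transfer {b} {u} {t} σ (_◅_ {j = u′} e@(uu′ , _) s) hu ¬ht | yes hu′ with transfer σ s hu′ ¬ht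
  ... | τ , r , ht , keep , off with hole? τ u′
  ...   | yes hτ = τ , r , ht , keep′ , off
    where
    keep′ : ∀ {w} → w ≢ u → Hole σ w → Hole τ w
    keep′ {w} w≢u h with w ≟ u′
    ... | yes refl = hτ
    ... | no  w≢u′ = keep w≢u′ h
  ...   | no ¬hτ = swap τ u u′
    , ⇝-trans r (hole-move τ uu′ (keep (~⇒≢ uu′) hu) ¬hτ)
    , hole-≡ τ (swap τ u u′) (swap-other τ (λ { refl → ¬ht hu }) (λ { refl → ¬ht hu′ })) ht
    , keep′
    , λ ¬s → trans (swap-other τ (λ { refl → ¬s (e ◅ s) }) (λ { refl → ¬s s })) (off ¬s)
    where
    keep′ : ∀ {w} → w ≢ u → Hole σ w → Hole (swap τ u u′) w
    keep′ {w} w≢u h with w ≟ u′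
    ... | yes refl = hole-≡ τ (swap τ u u′) (swap-right τ u u′) (keep (~⇒≢ uu′) hu)
    ... | no  w≢u′ = hole-≡ τ (swap τ u u′) (swap-other τ w≢u w≢u′) (keep w≢u′ h)
  transfer {b} {u} {t} σ (_◅_ {j = u′} e@(uu′ , _) s) hu ¬ht | no ¬hu′ with u′ ≟ t
  ... | yes refl = σ′ , hole-move σ uu′ hu ¬hu′ , hole-≡ σ σ′ (swap-right σ u u′) hu
    , (λ {w} w≢u h → hole-≡ σ σ′ (swap-other σ w≢u (λ { refl → ¬hu′ h })) h)
    , λ ¬s → swap-other σ (λ { refl → ¬s (e ◅ s) }) (λ { refl → ¬s s })
    where
    σ′ : Conf
    σ′ = swap σ u u′
  ... | no u′≢t with transfer (swap σ u u′) s (hole-≡ σ (swap σ u u′) (swap-right σ u u′) hu)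
        (λ h → ¬ht (hole-≡ (swap σ u u′) σ (sym (swap-other σ (λ { refl → ¬ht hu }) (≢-sym u′≢t))) h))
  ...   | τ , r , ht , keep , off = τ , ⇝-trans (hole-move σ uu′ hu ¬hu′) r , ht
    , (λ {w} w≢u h → keep (λ { refl → ¬hu′ h })
         (hole-≡ σ (swap σ u u′) (swap-other σ w≢u (λ { refl → ¬hu′ h })) h))
    , λ ¬s → trans (off ¬s) (swap-other σ (λ { refl → ¬s (e ◅ s) }) (λ { refl → ¬s s }))

  -- A target that is a hole already is struck from the supply `U`, lest it be moved away for a
  -- later target; any other target consumes one member of `U`.
  fill : ∀ {a b} D U → All (Side a b) D → All (Side a b) U → Unique U → length D ≤ length U
    → ∀ σ → All (Hole σ) U
    → Σ Conf λ τ → σ ⇝ τ × All (Hole τ) D × (∀ {w} → w ∉ U → Hole σ w → Hole τ w)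
      × (∀ {w} → ¬ Side a b w → τ ∙ w ≡ σ ∙ w)
  fill [] U sD sU u le σ hU = σ , ⇝-refl , [] , (λ _ h → h) , λ _ → refl
  fill (d ∷ D) U sD sU u le σ hU with hole? σ d
  fill (d ∷ D) U (_ ∷ sD) sU u le σ hU | yes hd
    with fill D (delete d U) sD (sub sU) (delete-unique d u)
           (s≤s⁻¹ (ℕₚ.≤-trans le (length-delete d u))) σ (sub hU)
    where
    sub : ∀ {P : V → Set} → All P U → All P (delete d U)
    sub al = All.tabulate λ x∈ → All.lookup al (proj₁ (delete-⊆ d {l = U} x∈))
  ... | τ , r , hD , keep , off = τ , r , keep (λ d∈ → proj₂ (delete-⊆ d {l = U} d∈) refl) hd ∷ hD
    , (λ w∉ → keep (w∉ ∘ proj₁ ∘ delete-⊆ d {l = U})) , off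
  fill (d ∷ D) (x ∷ U) (sd ∷ sD) (sx ∷ sU) (x∉ ∷ u) (s≤s le) σ (hx ∷ hU) | no ¬hd
    with transfer σ (sx ◅◅ reverse Avoid-sym sd) hx ¬hd
  ... | σ′ , r′ , hd , keep′ , off′
    with fill D U sD sU u le σ′ (All.zipWith (λ (x≢ , h) → keep′ (≢-sym x≢) h) (x∉ , hU))
  ... | τ , r , hD , keep , off = τ , ⇝-trans r′ r
    , keep (λ d∈ → ¬hd (All.lookup hU d∈)) hd ∷ hD
    , (λ w∉ h → keep (w∉ ∘ there) (keep′ (λ { refl → w∉ (here refl) }) h))
    , λ ¬s → trans (off ¬s) (off′ λ s → ¬s (s ◅◅ sd))

  -- Exchange across an edge, by the position of the holes

  side-self : ∀ {a x} → a ~ x → ¬ Side x a a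
  side-self ax s = side-≢ (~⇒≢ (~-sym ax)) s refl

  -- The holes are rearranged within the branch of `a′`, which contains neither `a` nor `b`, so the
  -- pair stays put until its way is clear. The `suc` counts `a′`.
  exchange-far : ∀ {a b a′} → a ~ b → (aa′ : a ~ a′) → a′ ≢ b → (r : Route a a′)
    → ∀ {p q} → Twins p q → ∀ σ → σ ∙ a ≡ p → σ ∙ b ≡ q
    → ∀ U → Unique U → All (Side a′ a) U → All (Hole σ) U → suc (length (targets r)) ≤ length U
    → Exchangeable σ
  exchange-far {a′ = a′} ab aa′ a′≢b r T σ σa σb U u sU hU le
    with fill (a′ ∷ targets r) U (ε ∷ All.map proj₁ (targets-side (~-sym aa′) r)) sU u le σ hU
  ... | τ , σ⇝τ , hD , _ , off = pull-back σ⇝τ (march ab (step a′ aa′ a′≢b r) T τ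
    (trans (off (side-self aa′)) σa)
    (trans (off (branches-disjoint ab aa′ (≢-sym a′≢b))) σb) hD)

  other-branch : ∀ {a x y u} → a ~ x → a ~ y → x ≢ y → Side x a u → ¬ Side y a u
  other-branch ax ay x≢y s s′ = branches-disjoint ax ay x≢y (reverse Avoid-sym s ◅◅ s′)

  -- Holes in two branches away from `b` are brought to `x` and `y`, each within its own branch; `a`
  -- is then a fork with room for the pair.
  exchange-two-branches : ∀ {a b x y u v} → a ~ b → a ~ x → a ~ y → x ≢ b → y ≢ b → x ≢ y
    → ∀ {p q} → Twins p q → ∀ σ → σ ∙ a ≡ p → σ ∙ b ≡ q
    → Side x a u → Side y a v → Hole σ u → Hole σ v → Exchangeable σ
  exchange-two-branches {a} {b} {x} {y} {u} {v} ab ax ay x≢b y≢b x≢y T σ σa σb su sv hu hv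
    with fill (x ∷ []) (u ∷ []) (ε ∷ []) (su ∷ []) ([] ∷ []) (s≤s z≤n) σ (hu ∷ [])
  ... | σ₁ , r₁ , hx ∷ [] , keep₁ , off₁
    with fill (y ∷ []) (v ∷ []) (ε ∷ []) (sv ∷ []) ([] ∷ []) (s≤s z≤n) σ₁
           (keep₁ (λ { (here refl) → other-branch ax ay x≢y su sv }) hv ∷ [])
  ... | σ₂ , r₂ , hy ∷ [] , keep₂ , off₂ = pull-back (⇝-trans r₁ r₂)
    (march ab (fork x y ax ay x≢b y≢b x≢y) T σ₂
      (trans (off₂ (side-self ay)) (trans (off₁ (side-self ax)) σa))
      (trans (off₂ (branches-disjoint ab ay (≢-sym y≢b)))
        (trans (off₁ (branches-disjoint ab ax (≢-sym x≢b))) σb))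
      (keep₂ (λ { (here refl) → branches-disjoint ax ay x≢y sv }) hx ∷ hy ∷ []))

  record Retreat (a b x : V) (p q : B) (σ : Conf) : Set where
    field
      conf   : Conf
      route  : σ ⇝ conf
      at-x   : conf ∙ x ≡ p
      at-a   : conf ∙ a ≡ q
      hole-b : Hole conf b
      spare  : Σ V λ w → w ≢ x × Side x a w × Hole conf w
      off    : ∀ {w} → ¬ Side x a w → w ≢ a → w ≢ b → conf ∙ w ≡ σ ∙ w

  retreat : ∀ {a b x u v} → a ~ b → a ~ x → x ≢ b → ∀ {p q} → Twins p q → ∀ σ
    → σ ∙ a ≡ p → σ ∙ b ≡ q → u ≢ v → Side x a u → Side x a v → Hole σ u → Hole σ v
    → Retreat a b x p q σ
  retreat {a} {b} {x} {u} {v} ab ax x≢b {p} {q} T σ σa σb u≢v su sv hu hv = choose (v ≟ x)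
    where
    enter : ∀ {u v} → Side x a u → Hole σ u → v ≢ x → Side x a v → Hole σ v → v ≢ u
      → Retreat a b x p q σ
    enter {u} {v} su hu v≢x sv hv v≢u
      with fill (x ∷ []) (u ∷ []) (ε ∷ []) (su ∷ []) ([] ∷ []) (s≤s z≤n) σ (hu ∷ [])
    ... | σ₁ , r₁ , hx ∷ [] , keep , off
      with advance ab ax x≢b T σ₁ (trans (off (side-self ax)) σa)
             (trans (off (branches-disjoint ab ax (≢-sym x≢b))) σb) hx
    ... | σ₂ , r₂ , σ₂x , σ₂a , hb , same = record
      { conf = σ₂ ; route = ⇝-trans r₁ r₂ ; at-x = σ₂x ; at-a = σ₂a ; hole-b = hb
      ; spare = v , v≢x , sv , hole-≡ σ₁ σ₂
          (same (λ { refl → side-self ax sv }) (λ { refl → branches-disjoint ab ax (≢-sym x≢b) sv }) v≢x)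
          (keep (λ { (here v≡u) → v≢u v≡u }) hv)
      ; off = λ ¬s w≢a w≢b → trans (same w≢a w≢b (λ { refl → ¬s ε })) (off ¬s) }
    -- A hole already at `x` must be the one that is entered, since the spare hole has to differ
    -- from `x`.
    choose : Dec (v ≡ x) → Retreat a b x p q σ
    choose (no v≢x)   = enter su hu v≢x sv hv (≢-sym u≢v)
    choose (yes refl) = enter sv hv u≢v su hu u≢v

  -- Holes in different branches at `a` are dealt with at once; a common branch is left to the
  -- continuation `same`.
  split : ∀ {a b u v} → a ~ b → ∀ {p q} → Twins p q → ∀ σ → σ ∙ a ≡ p → σ ∙ b ≡ q
    → Side a b u → Side a b v → Hole σ u → Hole σ v
    → (∀ {x} → a ~ x → x ≢ b → Side x a u → Side x a v → Exchangeable σ) → Exchangeable σ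
  split ab T σ σa σb su sv hu hv same with descend su | descend sv
  ... | inj₁ u≡a | _ = ⊥-elim (twin-≢ T σ σa hu u≡a)
  ... | inj₂ _ | inj₁ v≡a = ⊥-elim (twin-≢ T σ σa hv v≡a)
  ... | inj₂ (x , ax , x≢b , sx) | inj₂ (y , ay , y≢b , sy) with x ≟ y
  ...   | yes refl = same ax x≢b sx sy
  ...   | no  x≢y  = exchange-two-branches ab ax ay x≢b y≢b x≢y T σ σa σb sx sy hu hv

  third-neighbour : ∀ {a b x y} → a ~ x → a ~ y → x ≢ b → y ≢ b → x ≢ y
    → ∀ z → Σ V λ w → a ~ w × w ≢ b × w ≢ z
  third-neighbour {x = x} {y} ax ay x≢b y≢b x≢y z with x ≟ z
  ... | yes refl = y , ay , y≢b , ≢-sym x≢y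
  ... | no  x≢z  = x , ax , x≢b , x≢z

  -- If both holes lie in one branch x, then p and q withdraw two steps into it; the holes this
  -- leaves at a and b, together with g, are enough to come back out through the fork at a.
  exchange-at-near-fork : ∀ {a b x y u v g} → a ~ b → a ~ x → a ~ y → x ≢ b → y ≢ b → x ≢ y
    → ∀ {p q} → Twins p q → ∀ σ → σ ∙ a ≡ p → σ ∙ b ≡ q
    → u ≢ v → Side a b u → Side a b v → Hole σ u → Hole σ v → Side b a g → Hole σ g
    → Exchangeable σ
  exchange-at-near-fork {a} {b} {g = g} ab ax₀ ay₀ x₀≢b y₀≢b x₀≢y₀ T σ σa σb u≢v su sv hu hv sg hg =
    split ab T σ σa σb su sv hu hv together
    where
    together : ∀ {x} → a ~ x → x ≢ b → Side x a _ → Side x a _ → Exchangeable σ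
    together {x} ax x≢b su sv = deeper spare
      where
      open Retreat (retreat ab ax x≢b T σ σa σb u≢v su sv hu hv)
      b≢a : b ≢ a
      b≢a = ~⇒≢ (~-sym ab)
      g∉ : ¬ Side x a g
      g∉ = other-branch ab ax (≢-sym x≢b) sg
      b∉ : ¬ Side x a b
      b∉ = branches-disjoint ab ax (≢-sym x≢b)
      g≢a : g ≢ a
      g≢a = twin-≢ T σ σa hg
      g≢b : g ≢ b
      g≢b = twin-≢ (twins-sym T) σ σb hg
      deeper : (Σ V λ w → w ≢ x × Side x a w × Hole conf w) → Exchangeable σ
      deeper (w , w≢x , sw , hw) with descend sw
      ... | inj₁ w≡x = ⊥-elim (w≢x w≡x)
      ... | inj₂ (x′ , xx′ , x′≢a , sw′)
        with fill (x′ ∷ []) (w ∷ []) (ε ∷ []) (sw′ ∷ []) ([] ∷ []) (s≤s z≤n) conf (hw ∷ [])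
      ... | τ , r , hx′ ∷ [] , keep , off′
        with advance (~-sym ax) xx′ x′≢a T τ (trans (off′ (side-self xx′)) at-x)
               (trans (off′ (branches-disjoint (~-sym ax) xx′ (≢-sym x′≢a))) at-a) hx′
      ... | υ , r′ , υx′ , υx , ha , same with third-neighbour ax₀ ay₀ x₀≢b y₀≢b x₀≢y₀ x
      ... | z , az , z≢b , z≢x = pull-back (⇝-trans route (⇝-trans r r′))
        -- On the way back `a`, `b` and `z` must be vacated, and the holes at `g`, `a` and `b` are
        -- exactly three.
        (exchange-far xx′ (~-sym ax) (≢-sym x′≢a) (fork b z ab az (≢-sym x≢b) z≢x (≢-sym z≢b))
          (twins-sym T) υ υx υx′ (g ∷ a ∷ b ∷ [])
          ((g≢a ∷ g≢b ∷ []) ∷ (≢-sym b≢a ∷ []) ∷ [] ∷ [])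
          (lift-side ax ab (≢-sym x≢b) sg ∷ ε ∷ lift-side ax ab (≢-sym x≢b) ε ∷ [])
          (unmoved g∉ g≢a (hole-≡ σ conf (off g∉ g≢a g≢b) hg) ∷ ha ∷ unmoved b∉ b≢a hole-b ∷ [])
          ℕₚ.≤-refl)
        where
        unmoved : ∀ {d} → ¬ Side x a d → d ≢ a → Hole conf d → Hole υ d
        unmoved d∉ d≢a h = hole-≡ τ υ
          (same (λ { refl → d∉ ε }) d≢a (λ { refl → d∉ (lift-side (~-sym ax) xx′ x′≢a ε) }))
          (keep (λ { (here refl) → d∉ sw }) h)

  -- After a first step all holes are beyond `a′`, as `exchange-far` requires. If `a` is the fork
  -- itself, they may crowd into one branch, and the hole `g` across the edge helps.
  exchange-along-funnel : ∀ {a b} → a ~ b → (r : Route b a) → Funnel r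
    → ∀ {p q} → Twins p q → ∀ σ → σ ∙ a ≡ p → σ ∙ b ≡ q
    → ∀ {U} → Unique U → All (λ u → Hole σ u × Side a b u) U → length (targets r) ≤ length U
    → ∀ {g} → Side b a g → Hole σ g → Exchangeable σ
  exchange-along-funnel ab (fork x y ax ay x≢b y≢b x≢y) _ T σ σa σb
    {u ∷ v ∷ _} ((u≢v ∷ _) ∷ _) ((hu , su) ∷ (hv , sv) ∷ _) _ sg hg =
    exchange-at-near-fork ab ax ay x≢b y≢b x≢y T σ σa σb u≢v su sv hu hv sg hg
  exchange-along-funnel ab (fork _ _ _ _ _ _ _) _ T σ σa σb {_ ∷ []} _ _ (s≤s ())
  exchange-along-funnel ab (step a′ aa′ a′≢b r) funnel T σ σa σb {U} u al le _ _ =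
    exchange-far ab aa′ a′≢b r T σ σa σb U u
      (All.map (λ (h , s) → funnel s (twin-≢ T σ σa h)) al) (All.map proj₁ al) le

  -- Counting holes when there is no bridge

  module _ {m : ℕ} (2≤m : 2 ≤ m) (no-bridge : ¬ HasBridge X m)
    (holes : ∀ σ → Σ (List V) λ U → Unique U × All (Hole σ) U × m ≤ length U) where

    -- By `inner-bound`, the `m` holes exceed the inner vertices of both arms together, so on one
    -- side they exceed those of its arm, and that arm ends in a fork. The hole on the opposite side
    -- serves as `g`.
    exchange-holes-both-sides : ∀ {a b} → a ~ b → ∀ {p q} → Twins p q → ∀ σ → σ ∙ a ≡ p → σ ∙ b ≡ q
      → ∀ {g h} → Side a b g → Hole σ g → Side b a h → Hole σ h → Exchangeable σ
    exchange-holes-both-sides {a} {b} ab T σ σa σb sg hg sh hh with holes σ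
    ... | U , u , hU , m≤ with separate (side-cover ab) u
    ... | Uᵃ , Uᵇ , eq , (uᵃ , sᵃ) , (uᵇ , sᵇ)
      = by-size (length Uᵃ ℕₚ.≤? length (inner rᵃ)) (length Uᵇ ℕₚ.≤? length (inner rᵇ))
      where
      ba : b ~ a
      ba = ~-sym ab
      rᵃ : Arm b a
      rᵃ = arm ab
      rᵇ : Arm a b
      rᵇ = arm ba
      holesᵃ : All (λ u → Hole σ u × Side a b u) Uᵃ
      holesᵃ = All.map (λ (∈U , s) → All.lookup hU ∈U , s) sᵃ
      holesᵇ : All (λ u → Hole σ u × Side b a u) Uᵇ
      holesᵇ = All.map (λ (∈U , s) → All.lookup hU ∈U , s) sᵇ
      by-size : Dec (length Uᵃ ≤ length (inner rᵃ)) → Dec (length Uᵇ ≤ length (inner rᵇ))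
        → Exchangeable σ
      by-size (no big) _
        with many-behind ab rᵃ uᵃ (All.map (λ (h , s) → s , twin-≢ T σ σa h) holesᵃ) (ℕₚ.≰⇒> big)
      ... | r , f , le = exchange-along-funnel ab r f T σ σa σb uᵃ holesᵃ le sh hh
      by-size (yes _) (no big)
        with many-behind ba rᵇ uᵇ (All.map (λ (h , s) → s , twin-≢ (twins-sym T) σ σb h) holesᵇ) (ℕₚ.≰⇒> big)
      ... | r , f , le = exchange-along-funnel ba r f (twins-sym T) σ σb σa uᵇ holesᵇ le sg hg
      by-size (yes smallᵃ) (yes smallᵇ) = ⊥-elim (ℕₚ.<⇒≱ (inner-bound 2≤m no-bridge ab rᵃ rᵇ)
        (ℕₚ.≤-trans m≤ (ℕₚ.≤-trans (ℕₚ.≤-reflexive (sym eq)) (ℕₚ.+-mono-≤ smallᵃ smallᵇ))))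

    -- If both holes are in one branch, a retreat into it leaves a hole at `b` and keeps one ahead,
    -- so the edge `ax` has holes on both sides.
    exchange-holes-one-side : ∀ {a b} → a ~ b → ∀ {p q} → Twins p q → ∀ σ → σ ∙ a ≡ p → σ ∙ b ≡ q
      → ∀ {u v} → u ≢ v → Side a b u → Side a b v → Hole σ u → Hole σ v → Exchangeable σ
    exchange-holes-one-side {a} {b} ab {p} {q} T σ σa σb {u} {v} u≢v su sv hu hv =
      split ab T σ σa σb su sv hu hv together
      where
      together : ∀ {x} → a ~ x → x ≢ b → Side x a u → Side x a v → Exchangeable σ
      together {x} ax x≢b su sv = back (retreat ab ax x≢b T σ σa σb u≢v su sv hu hv)
        where
        back : Retreat a b x p q σ → Exchangeable σ
        back R with Retreat.spare R
        ... | w , _ , sw , hw = pull-back (Retreat.route R)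
          (exchange-holes-both-sides (~-sym ax) T (Retreat.conf R) (Retreat.at-x R) (Retreat.at-a R)
            sw hw (lift-side ax ab (≢-sym x≢b) ε) (Retreat.hole-b R))

    exchange : ∀ {a b} → a ~ b → ∀ {p q} → Twins p q → ∀ σ → σ ∙ a ≡ p → σ ∙ b ≡ q → Exchangeable σ
    exchange {a} {b} ab T σ σa σb with holes σ
    ... | []        , _ , _ , m≤ = ⊥-elim (ℕₚ.<⇒≱ 2≤m (ℕₚ.≤-trans m≤ z≤n))
    ... | _ ∷ []    , _ , _ , m≤ = ⊥-elim (ℕₚ.<⇒≱ 2≤m m≤)
    ... | u ∷ v ∷ _ , (u≢v ∷ _) ∷ _ , hu ∷ hv ∷ _ , _ with side-cover ab u | side-cover ab v
    ...   | inj₁ su | inj₁ sv = exchange-holes-one-side ab T σ σa σb u≢v su sv hu hv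
    ...   | inj₂ su | inj₂ sv = exchange-holes-one-side (~-sym ab) (twins-sym T) σ σb σa u≢v su sv hu hv
    ...   | inj₁ su | inj₂ sv = exchange-holes-both-sides ab T σ σa σb su hu sv hv
    ...   | inj₂ su | inj₁ sv = exchange-holes-both-sides ab T σ σa σb sv hv su hu

-- From exchanges to connectedness

module Connectedness {n : ℕ} (X : Graph (Fin n)) (conn : Connected X) (acyclic : ¬ HasCycle X)
  {t : ℕ} (k : Fin t → ℕ) (third : ThirdColour t k) where

  open Configurations X k

  rank : ∀ {c} r → colour r ≡ c → Fin (k c)
  rank (_ , j) refl = j

  rank-injective : ∀ {c} r s (e : colour r ≡ c) (f : colour s ≡ c) → rank r e ≡ rank s f → r ≡ s
  rank-injective _ _ refl refl refl = refl

  -- Configurations are injective, so ranks within the colour class embed `U` into `Fin (k c)`.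
  colour-class-bound : ∀ σ {c U} → Unique U → All (λ u → colour (σ ∙ u) ≡ c) U → length U ≤ k c
  colour-class-bound σ {c} {U} u al = Finₚ.injective⇒≤ {f = λ i → rank _ (has-colour i)} λ e →
    lookup-injective U u (∙-injective σ (rank-injective _ _ (has-colour _) (has-colour _) e))
    where
    has-colour : ∀ i → colour (σ ∙ lookup U i) ≡ c
    has-colour i = All.lookup al (∈-lookup i)

  many-holes : ∀ {m} c → m + k c ≤ n → ∀ σ
    → Σ (List (Fin n)) λ U → Unique U × All (λ u → colour (σ ∙ u) ≢ c) U × m ≤ length U
  many-holes {m} c ≤n σ with separate cover (allFin⁺ n)
    where
    cover : ∀ u → colour (σ ∙ u) ≡ c ⊎ colour (σ ∙ u) ≢ c
    cover u with colour (σ ∙ u) Finₚ.≟ c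
    ... | yes e = inj₁ e
    ... | no ne = inj₂ ne
  ... | Uᶜ , U , eq , (uᶜ , sᶜ) , (u , s) = U , u , All.map proj₂ s , ℕₚ.+-cancelˡ-≤ (k c) m (length U)
    (begin
      k c + m                ≡⟨ ℕₚ.+-comm (k c) m ⟩
      m + k c                ≤⟨ ≤n ⟩
      n                      ≡⟨ length-tabulate {n = n} (λ i → i) ⟨
      length (allFin n)      ≡⟨ eq ⟨
      length Uᶜ + length U   ≤⟨ ℕₚ.+-monoˡ-≤ (length U) (colour-class-bound σ uᶜ (All.map proj₂ sᶜ)) ⟩
      k c + length U         ∎)
    where open ℕₚ.≤-Reasoning

  module _ {m : ℕ} (2≤m : 2 ≤ m) (no-bridge : ¬ HasBridge X m) (large : ∀ c → m + k c ≤ n) where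

    swap-edge : ∀ σ {a b} → Adj X a b → σ ⇝ swap σ a b
    swap-edge σ {a} {b} ab with colour (σ ∙ a) Finₚ.≟ colour (σ ∙ b)
    ... | no  ne = move σ ab ne
    ... | yes a≡b = ⇝-trans (exchange 2≤m no-bridge (many-holes c (large c)) ab twins σ refl refl)
                      (≗⇒⇝ π-∙)
      where
      c : Fin t
      c = colour (σ ∙ a)
      -- The swap of two positions, rewritten as a permutation of labels; it preserves colours
      -- because the two labels share theirs.
      π : B ↔ B
      π = swap σ a b ↔-∘ ↔-sym σ
      π-∙ : ∀ u → Inverse.to π (σ ∙ u) ≡ swap σ a b ∙ u
      π-∙ u = cong (swap σ a b ∙_) (Inverse.inverseʳ σ refl)
      swap-colour : ∀ u → colour (swap σ a b ∙ u) ≡ colour (σ ∙ u)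
      swap-colour u with u Finₚ.≟ a
      ... | yes refl = trans (cong colour (swap-left σ a b)) (sym a≡b)
      ... | no  u≢a with u Finₚ.≟ b
      ...   | yes refl = trans (cong colour (swap-right σ a b)) a≡b
      ...   | no  u≢b  = cong colour (swap-other σ u≢a u≢b)
      π-colour : ∀ r → colour (Inverse.to π r) ≡ colour r
      π-colour r with position σ r
      ... | u , refl = trans (cong colour (π-∙ u)) (swap-colour u)
      open Exchange X conn acyclic k third c π π-colour
      twins : Twins (σ ∙ a) (σ ∙ b)
      twins = record
        { colourˡ = refl ; colourʳ = sym a≡b
        ; π-left  = trans (π-∙ a) (swap-left σ a b)
        ; π-right = trans (π-∙ b) (swap-right σ a b)
        ; π-other = other }
        where
        other : ∀ r → r ≢ σ ∙ a → r ≢ σ ∙ b → Inverse.to π r ≡ r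
        other r r≢a r≢b with position σ r
        ... | u , refl = trans (π-∙ u) (swap-other σ (λ { refl → r≢a refl }) (λ { refl → r≢b refl }))

    fs-connected : FSConnected X (CompleteMultipartite t k)
    fs-connected σ τ with edge-swaps-suffice conn swap-edge σ τ
    ... | reach ρ w e = ρ , w , e

-- Class sizes and the final assembly

third-index : ∀ {s} (i j : Fin (suc (suc (suc s)))) → Σ (Fin (suc (suc (suc s)))) λ z → z ≢ i × z ≢ j
third-index zero          zero          = suc zero , (λ ()) , λ ()
third-index zero          (suc zero)    = suc (suc zero) , (λ ()) , λ ()
third-index zero          (suc (suc _)) = suc zero , (λ ()) , λ ()
third-index (suc zero)    zero          = suc (suc zero) , (λ ()) , λ ()
third-index (suc (suc _)) zero          = suc zero , (λ ()) , λ ()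
third-index (suc _)       (suc _)       = zero , (λ ()) , λ ()

third-colour : ∀ s → 2 < suc s → (k : Fin (suc s) → ℕ) → (∀ i → 1 ≤ k i) → ThirdColour (suc s) k
third-colour (suc (suc s)) _ k 1≤k i j with third-index i j
... | z , z≢i , z≢j = (z , fromℕ< (1≤k z)) , z≢i , z≢j
third-colour zero       (s≤s ())
third-colour (suc zero) (s≤s (s≤s ()))

-- Each of the first `s` classes contributes at least 1.
s+last≤sum : ∀ s (k : Fin (suc s) → ℕ) → (∀ i → 1 ≤ k i) → s + k (fromℕ s) ≤ sumFin (suc s) k
s+last≤sum zero    k 1≤k = ℕₚ.m≤m+n (k zero) 0
s+last≤sum (suc s) k 1≤k = ℕₚ.+-mono-≤ (1≤k zero) (s+last≤sum s (λ i → k (suc i)) (λ i → 1≤k (suc i)))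

theorem1p6 : (s : ℕ) → 2 < suc s → (k : Fin (suc s) → ℕ)
    → (∀ i → 1 ≤ k i)
    → (∀ i j → i ≤ᶠ j → k i ≤ k j)
    → 4 ≤ sumFin (suc s) k
    → (X : Graph (Fin (sumFin (suc s) k)))
    → IsTree X
    → ¬ HasBridge X (sumFin (suc s) k ∸ k (fromℕ s))
    → FSConnected X (CompleteMultipartite (suc s) k)
theorem1p6 s 2<t k 1≤k mono _ X (conn , acyclic) no-bridge =
  Connectedness.fs-connected X conn acyclic k (third-colour s 2<t k 1≤k)
    -- With `t = suc s`, this is `2 ≤ s ≤ n - k_t`, so the excluded bridge has at least one edge.
    (ℕₚ.≤-trans (s≤s⁻¹ 2<t) (ℕₚ.m+n≤o⇒m≤o∸n s (s+last≤sum s k 1≤k))) no-bridge large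
  where
  N : ℕ
  N = sumFin (suc s) k
  last≤N : k (fromℕ s) ≤ N
  last≤N = ℕₚ.≤-trans (ℕₚ.m≤n+m (k (fromℕ s)) s) (s+last≤sum s k 1≤k)
  -- The last class is the largest, so every colour leaves at least `n - k_t` holes.
  large : ∀ c → N ∸ k (fromℕ s) + k c ≤ N
  large c = ℕₚ.≤-trans (ℕₚ.+-monoʳ-≤ (N ∸ k (fromℕ s)) (mono c (fromℕ s) (Finₚ.≤fromℕ c)))
    (ℕₚ.≤-reflexive (ℕₚ.m∸n+n≡m last≤N))
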